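{- Let $A\subset\mathbb Z^n$ be a finite set with $0\in A$ such that $A$ generates $\mathbb Z^n$ as a $\mathbb Z$-module. There exists a constant $N_A$ such that for every integer $N\geq N_A$, $$NA = (NH(A)\cap \mathbb Z^n) \setminus \mathcal E_N(A), \quad\text{where}\quad \mathcal E_N(A):= \mathcal E(A)\cup \bigcup_{a\in A} \big(aN-\mathcal E(a-A) \big).$$
   Context: For an integer $N\ge1$, $NA=\{a_1+\cdots+a_N: a_i\in A\}$ (repetitions allowed). For a finite set $X\subset\mathbb Z^n$: $H(X)=\{\sum_{x\in X} c_x x: c_x\ge 0, \sum_x c_x=1\}$ is its convex hull, $NH(X)=\{Ny: y\in H(X)\}$; $C_X=\{\sum_{x\in X}c_x x: c_x\ge0\}$ is the cone it generates; $\mathcal P(X)=\{\sum_{x\in X} n_x x: n_x\in\mathbb Z_{\ge0}\}$; and the exceptional set is $\mathcal E(X)=(C_X\cap\mathbb Z^n)\setminus\mathcal P(X)$. For $a\in A$, $a-A=\{a-x: x\in A\}$, and for $v\in\mathbb Z^n$ and a set $Y$, $v-Y=\{v-y:y\in Y\}$.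
   Formalization: The coefficients c_x in the convex hull H(A) and in the cones C_X are taken rational instead of real; for integer points of hulls and cones of finite integer sets this gives the same points, by Carathéodory's theorem. -}

module Defs where

open import Data.Nat using (ℕ; zero; suc)
open import Data.Integer as ℤ using (ℤ)
open import Data.Rational as ℚ using (ℚ; 0ℚ; 1ℚ)
open import Data.Vec using (Vec; []; _∷_; map; zipWith; replicate)
open import Data.List as L using (List)
open import Data.List.Membership.Propositional using (_∈_)
open import Data.Vec.Relation.Unary.All as VAll using ()
open import Data.Product using (Σ; _×_)
open import Data.Sum using (_⊎_)
open import Relation.Nullary using (¬_)
open import Relation.Binary.PropositionalEquality using (_≡_)

Pt : ℕ → Set
Pt n = Vec ℤ n

PtQ : ℕ → Set
PtQ n = Vec ℚ n

Subset : ℕ → Set₁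
Subset n = Pt n → Set

0v : ∀ {n} → Pt n
0v = replicate _ (ℤ.+ 0)

_+v_ : ∀ {n} → Pt n → Pt n → Pt n
_+v_ = zipWith ℤ._+_

_-v_ : ∀ {n} → Pt n → Pt n → Pt n
_-v_ = zipWith ℤ._-_

_·v_ : ∀ {n} → ℤ → Pt n → Pt n
c ·v x = map (c ℤ.*_) x

0q : ∀ {n} → PtQ n
0q = replicate _ 0ℚ

_+q_ : ∀ {n} → PtQ n → PtQ n → PtQ n
_+q_ = zipWith ℚ._+_

_·q_ : ∀ {n} → ℚ → PtQ n → PtQ n
c ·q x = map (c ℚ.*_) x

toℚ : ℤ → ℚ
toℚ z = z ℚ./ 1

toℚv : ∀ {n} → Pt n → PtQ n
toℚv = map toℚ

-- A finite set X ⊂ ℤⁿ is given by a list of its elements.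
-- Coefficient families indexed by the positions of the list.

lincombℤ : ∀ {n} (X : List (Pt n)) → Vec ℤ (L.length X) → Pt n
lincombℤ L.[] [] = 0v
lincombℤ (x L.∷ X) (c ∷ cs) = (c ·v x) +v lincombℤ X cs

lincombℕ : ∀ {n} (X : List (Pt n)) → Vec ℕ (L.length X) → Pt n
lincombℕ L.[] [] = 0v
lincombℕ (x L.∷ X) (c ∷ cs) = ((ℤ.+ c) ·v x) +v lincombℕ X cs

lincombℚ : ∀ {n} (X : List (Pt n)) → Vec ℚ (L.length X) → PtQ n
lincombℚ L.[] [] = 0q
lincombℚ (x L.∷ X) (c ∷ cs) = (c ·q toℚv x) +q lincombℚ X cs

sumℚ : ∀ {k} → Vec ℚ k → ℚ
sumℚ [] = 0ℚ
sumℚ (c ∷ cs) = c ℚ.+ sumℚ cs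

sumv : ∀ {n k} → Vec (Pt n) k → Pt n
sumv [] = 0v
sumv (x ∷ xs) = x +v sumv xs

Nonneg : ∀ {k} → Vec ℚ k → Set
Nonneg cs = VAll.All (0ℚ ℚ.≤_) cs

Generates : ∀ {n} → List (Pt n) → Set
Generates {n} X = (v : Pt n) → Σ (Vec ℤ (L.length X)) λ cs → lincombℤ X cs ≡ v

SumSet : ∀ {n} → ℕ → List (Pt n) → Subset n
SumSet N A v = Σ (Vec _ N) λ as → VAll.All (_∈ A) as × sumv as ≡ v

-- NH(X) ∩ ℤⁿ : integer points v with v = N y, y in the convex hull of X
-- (convex coefficients taken in ℚ)
NHull : ∀ {n} → ℕ → List (Pt n) → Subset n
NHull N X v = Σ (Vec ℚ (L.length X)) λ cs →
  Nonneg cs × sumℚ cs ≡ 1ℚ × toℚv v ≡ toℚ (ℤ.+ N) ·q lincombℚ X cs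

Cone : ∀ {n} → List (Pt n) → Subset n
Cone X v = Σ (Vec ℚ (L.length X)) λ cs → Nonneg cs × lincombℚ X cs ≡ toℚv v

Semigrp : ∀ {n} → List (Pt n) → Subset n
Semigrp X v = Σ (Vec ℕ (L.length X)) λ ns → lincombℕ X ns ≡ v

Exc : ∀ {n} → List (Pt n) → Subset n
Exc X v = Cone X v × ¬ Semigrp X v

_−set_ : ∀ {n} → Pt n → List (Pt n) → List (Pt n)
a −set A = L.map (a -v_) A

ExcN : ∀ {n} → ℕ → List (Pt n) → Subset n
ExcN N A v = Exc A v ⊎ Σ _ λ a → a ∈ A × Σ _ λ w → Exc (a −set A) w × v ≡ ((ℤ.+ N) ·v a) -v w

{-# OPTIONS --safe #-}

-- Write v ∈ NH(A) with a common denominator as D v = N Σ pₓ x, Σ pₓ = D, and let a be a point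
-- whose weight pₐ is at least D / |A|.  Then w = N a - v lies in the cone of a - A, so, as v
-- avoids the exceptional set, w = Σ mₓ (a - x) with natural mₓ.  The nonnegative integer
-- solutions (p, q) of Σ pₓ (a - x) = Σ qₓ (a - x) have, up to positive multiples, a finite set of
-- generators.  Expanding a multiple of (N p, D m) in them and splitting off multiples of D from
-- the coefficients turns m into another natural solution m′ with m′ₓ ≤ N pₓ / D + Bₓ, where B
-- depends only on A and a.  The coefficient of a itself is irrelevant since a - a = 0, and the
-- others add up to at most N - N pₐ / D + Σ Bₓ ≤ N once N ≥ |A| Σ Bₓ.
--
-- The representation of w is only obtained up to double negation; this suffices because
-- membership in the sumset is decidable.
module Submission where

open import Defs
open import Data.Fin as Fin using (Fin; zero; suc)
import Data.Fin.Properties as Fin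
open import Data.Integer using (ℤ; +_; 0ℤ; 1ℤ; _+_; _-_; _*_; -_; _≤_; _<_; ∣_∣; +≤+; +<+; nonNegative)
open import Data.Integer.Properties
open import Algebra.Properties.Semiring.Sum +-*-semiring using (sum; sum-cong-≗)
open import Data.Integer.Tactic.RingSolver using (solve-∀)
open import Data.List as L using (List; []; _∷_; _++_)
import Data.List.Properties as L
open import Data.List.Membership.Propositional using (_∈_; find)
open import Data.List.Membership.Propositional.Properties
  using (∈-map⁺; ∈-cartesianProductWith⁺; ∈-++⁺ˡ; ∈-++⁺ʳ; ∈-tabulate⁺; ∈-lookup)
open import Data.List.Relation.Unary.All as All using (All; []; _∷_)
import Data.List.Relation.Unary.All.Properties as All
open import Data.List.Relation.Unary.Any as Any using (here; there; index)
import Data.List.Relation.Unary.Any.Properties as Any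
open import Data.Nat as ℕ using (ℕ; zero; suc)
open import Data.Nat.Coprimality as Coprime using (1-coprimeTo)
import Data.Nat.DivMod as ℕ
import Data.Nat.Properties as ℕ
open import Data.Product using (Σ; ∃; ∃₂; _×_; _,_; proj₁; proj₂)
open import Data.Rational as ℚ using (ℚ; 0ℚ; 1ℚ; mkℚ)
import Data.Rational.Properties as ℚ
import Data.Rational.Unnormalised as ℚᵘ
import Data.Rational.Unnormalised.Properties as ℚᵘ
open import Data.Sum using (_⊎_; inj₁; inj₂; [_,_]′)
open import Data.Vec as V using (Vec; []; _∷_; lookup)
import Data.Vec.Properties as V
open import Data.Vec.Relation.Unary.All using ([]; _∷_)
open import Function using (_∘_)
open import Function.Bundles using (_⇔_; mk⇔)
open import Relation.Binary.Definitions using (tri<; tri≈; tri>)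
open import Relation.Binary.PropositionalEquality
open import Relation.Nullary using (¬_; Dec; yes; no; contradiction)
open import Relation.Nullary.Decidable as Dec using (_×-dec_; decidable-stable)

-- Nonnegative solutions of homogeneous linear systems

-- Functionals carry their own congruence law because families are compared pointwise, without
-- function extensionality. The single law `linear` yields additivity and homogeneity by choosing
-- the scalars.
record Linear (I : Set) : Set where
  field
    ⟦_⟧ : (I → ℤ) → ℤ
    ⟦⟧-cong : ∀ {u w} → u ≗ w → ⟦ u ⟧ ≡ ⟦ w ⟧
    linear : ∀ a b u w → ⟦ (λ i → a * u i + b * w i) ⟧ ≡ a * ⟦ u ⟧ + b * ⟦ w ⟧

  ⟦0⟧ : ∀ {u} → (∀ i → u i ≡ 0ℤ) → ⟦ u ⟧ ≡ 0ℤ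
  ⟦0⟧ {u} u≡0 = trans (⟦⟧-cong u≡0) (linear 0ℤ 0ℤ u u)

  ⟦+⟧ : ∀ u w → ⟦ (λ i → u i + w i) ⟧ ≡ ⟦ u ⟧ + ⟦ w ⟧
  ⟦+⟧ u w = begin
    ⟦ (λ i → u i + w i) ⟧            ≡⟨ ⟦⟧-cong (λ i → cong₂ _+_ (*-identityˡ (u i)) (*-identityˡ (w i))) ⟨
    ⟦ (λ i → 1ℤ * u i + 1ℤ * w i) ⟧  ≡⟨ linear 1ℤ 1ℤ u w ⟩
    1ℤ * ⟦ u ⟧ + 1ℤ * ⟦ w ⟧          ≡⟨ cong₂ _+_ (*-identityˡ ⟦ u ⟧) (*-identityˡ ⟦ w ⟧) ⟩
    ⟦ u ⟧ + ⟦ w ⟧                    ∎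
    where open ≡-Reasoning

  ⟦*⟧ : ∀ a u → ⟦ (λ i → a * u i) ⟧ ≡ a * ⟦ u ⟧
  ⟦*⟧ a u = begin
    ⟦ (λ i → a * u i) ⟧             ≡⟨ ⟦⟧-cong (λ i → +-identityʳ (a * u i)) ⟨
    ⟦ (λ i → a * u i + 0ℤ * u i) ⟧  ≡⟨ linear a 0ℤ u u ⟩
    a * ⟦ u ⟧ + 0ℤ                  ≡⟨ +-identityʳ _ ⟩
    a * ⟦ u ⟧                       ∎
    where open ≡-Reasoning

open Linear

NonNeg : {I : Set} → (I → ℤ) → Set
NonNeg u = ∀ i → 0ℤ ≤ u i

0≤+ : ∀ {a b} → 0ℤ ≤ a → 0ℤ ≤ b → 0ℤ ≤ a + b
0≤+ = +-mono-≤

0≤* : ∀ {a b} → 0ℤ ≤ a → 0ℤ ≤ b → 0ℤ ≤ a * b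
0≤* {+ m} {+ n} _ _ = subst (0ℤ ≤_) (pos-* m n) (+≤+ ℕ.z≤n)

-- The additive monoid generated by `S`, as finite sums with repetition: a natural coefficient is a
-- repeated `cons`. The pointwise equations let a sum be known under any extensionally equal name.
data Span {I : Set} (S : (I → ℤ) → Set) : (I → ℤ) → Set where
  nil  : ∀ {z} → (∀ i → z i ≡ 0ℤ) → Span S z
  cons : ∀ {g y z} → S g → Span S y → (∀ i → z i ≡ g i + y i) → Span S z

module _ {I : Set} {S : (I → ℤ) → Set} where

  Span-cong : ∀ {u w} → u ≗ w → Span S u → Span S w
  Span-cong u≗w (nil u≡0)      = nil (λ i → trans (sym (u≗w i)) (u≡0 i))
  Span-cong u≗w (cons s c u≡)  = cons s c (λ i → trans (sym (u≗w i)) (u≡ i))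

  Span-gen : ∀ {g} → S g → Span S g
  Span-gen s = cons s (nil (λ _ → refl)) (λ i → sym (+-identityʳ _))

  Span-+ : ∀ {u w} → Span S u → Span S w → Span S (λ i → u i + w i)
  Span-+ {w = w} (nil u≡0) c = Span-cong (λ i → sym (trans (cong (_+ w i) (u≡0 i)) (+-identityˡ (w i)))) c
  Span-+ {w = w} (cons {g} {y} s c u≡) d =
    cons s (Span-+ c d) (λ i → trans (cong (_+ w i) (u≡ i)) (+-assoc (g i) (y i) (w i)))

  Span-* : ∀ n {u} → Span S u → Span S (λ i → + n * u i)
  Span-* zero    c = nil (λ _ → refl)
  Span-* (suc n) {u} c = Span-cong (λ i → sym (suc-* (+ n) (u i))) (Span-+ c (Span-* n c))


  Span-map : ∀ {T : (I → ℤ) → Set} → (∀ {g} → S g → T g) → ∀ {u} → Span S u → Span T u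
  Span-map S⊆T (nil z)      = nil z
  Span-map S⊆T (cons s c e) = cons (S⊆T s) (Span-map S⊆T c) e

  Span-nonNeg : (∀ {g} → S g → NonNeg g) → ∀ {u} → Span S u → NonNeg u
  Span-nonNeg S≥0 (nil u≡0) i      = ≤-reflexive (sym (u≡0 i))
  Span-nonNeg S≥0 (cons s c u≡) i  =
    subst (0ℤ ≤_) (sym (u≡ i)) (0≤+ (S≥0 s i) (Span-nonNeg S≥0 c i))

  Span-kernel : (f : Linear I) → (∀ {g} → S g → ⟦ f ⟧ g ≡ 0ℤ) → ∀ {u} → Span S u → ⟦ f ⟧ u ≡ 0ℤ
  Span-kernel f S≡0 (nil u≡0) = ⟦0⟧ f u≡0
  Span-kernel f S≡0 (cons {g} {y} s c u≡) = begin
    ⟦ f ⟧ _                ≡⟨ ⟦⟧-cong f u≡ ⟩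
    ⟦ f ⟧ (λ i → g i + y i) ≡⟨ ⟦+⟧ f g y ⟩
    ⟦ f ⟧ g + ⟦ f ⟧ y       ≡⟨ cong₂ _+_ (S≡0 s) (Span-kernel f S≡0 c) ⟩
    0ℤ                     ∎
    where open ≡-Reasoning

  -- A sum with at least one summand has positive value, so only the empty sum, which is zero,
  -- escapes positivity.
  Span-positive : (f : Linear I) → (∀ {g} → S g → 0ℤ < ⟦ f ⟧ g) →
                  ∀ {u} → Span S u → (∀ i → u i ≡ 0ℤ) ⊎ 0ℤ < ⟦ f ⟧ u
  Span-positive f S>0 (nil u≡0) = inj₁ u≡0
  Span-positive f S>0 (cons {g} {y} s c u≡) =
    inj₂ (subst (0ℤ <_) (sym fu≡) (+-mono-<-≤ (S>0 s) (0≤fy (Span-positive f S>0 c))))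
    where
    fu≡ = trans (⟦⟧-cong f u≡) (⟦+⟧ f g y)
    0≤fy : (∀ i → y i ≡ 0ℤ) ⊎ 0ℤ < ⟦ f ⟧ y → 0ℤ ≤ ⟦ f ⟧ y
    0≤fy (inj₁ y≡0) = ≤-reflexive (sym (⟦0⟧ f y≡0))
    0≤fy (inj₂ 0<)  = <⇒≤ 0<

negate : {I : Set} → Linear I → Linear I
negate f = record
  { ⟦_⟧     = λ u → - ⟦ f ⟧ u
  ; ⟦⟧-cong = cong -_ ∘ ⟦⟧-cong f
  ; linear  = λ a b u w → trans (cong -_ (linear f a b u w)) (lem a b (⟦ f ⟧ u) (⟦ f ⟧ w))
  }
  where
  lem : ∀ a b x y → - (a * x + b * y) ≡ a * - x + b * - y
  lem = solve-∀

-- One step of the double description method.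
module Intersect {I : Set} (f : Linear I) (G : List (I → ℤ)) where

  F : (I → ℤ) → ℤ
  F = ⟦ f ⟧

  Pos Neg : (I → ℤ) → Set
  Pos g = g ∈ G × 0ℤ < F g
  Neg h = h ∈ G × 0ℤ < - F h

  -- Generators off the hyperplane become the zero family instead of being filtered out. Zero is a
  -- nonnegative solution of every equation, so it may stay in the list.
  single : (I → ℤ) → I → ℤ
  single g with F g ≟ 0ℤ
  ... | yes _ = g
  ... | no  _ = λ _ → 0ℤ

  -- For `g` and `h` on opposite sides of the hyperplane this is the positive combination on which
  -- `F` cancels. Other pairs give zero.
  pair : (I → ℤ) → (I → ℤ) → I → ℤ
  pair g h with (0ℤ <? F g) ×-dec (0ℤ <? - F h)
  ... | yes _ = λ i → F g * h i + - F h * g i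
  ... | no  _ = λ _ → 0ℤ

  G′ : List (I → ℤ)
  G′ = L.map single G ++ L.cartesianProductWith pair G G

  single-∈ : ∀ {g} → g ∈ G → F g ≡ 0ℤ → g ∈ G′
  single-∈ {g} g∈G Fg≡0 = subst (_∈ G′) single-≡ (∈-++⁺ˡ (∈-map⁺ single g∈G))
    where
    single-≡ : single g ≡ g
    single-≡ with F g ≟ 0ℤ
    ... | yes _ = refl
    ... | no ≢0 = contradiction Fg≡0 ≢0

  pair-∈ : ∀ {g h} → Pos g → Neg h → (λ i → F g * h i + - F h * g i) ∈ G′
  pair-∈ {g} {h} (g∈G , 0<g) (h∈G , 0<h) =
    subst (_∈ G′) pair-≡ (∈-++⁺ʳ (L.map single G) (∈-cartesianProductWith⁺ pair g∈G h∈G))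
    where
    pair-≡ : pair g h ≡ (λ i → F g * h i + - F h * g i)
    pair-≡ with (0ℤ <? F g) ×-dec (0ℤ <? - F h)
    ... | yes _ = refl
    ... | no ¬p = contradiction (0<g , 0<h) ¬p

  -- An induction principle that hides the case distinctions inside `single` and `pair`.
  G′-All : {P : (I → ℤ) → Set} → P (λ _ → 0ℤ) → (∀ {g} → g ∈ G → F g ≡ 0ℤ → P g) →
           (∀ {g h} → Pos g → Neg h → P (λ i → F g * h i + - F h * g i)) → All P G′
  G′-All {P} P0 Psingle Ppair = All.++⁺
    (All.map⁺ (All.tabulate single-P))
    (All.cartesianProductWith⁺ (setoid _) (setoid _) pair G G pair-P)
    where
    single-P : ∀ {g} → g ∈ G → P (single g)
    single-P {g} g∈G with F g ≟ 0ℤ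
    ... | yes ≡0 = Psingle g∈G ≡0
    ... | no  _  = P0
    pair-P : ∀ {g h} → g ∈ G → h ∈ G → P (pair g h)
    pair-P {g} {h} g∈G h∈G with (0ℤ <? F g) ×-dec (0ℤ <? - F h)
    ... | yes (0<g , 0<h) = Ppair (g∈G , 0<g) (h∈G , 0<h)
    ... | no  _           = P0

  kernel : All (λ g → F g ≡ 0ℤ) G′
  kernel = G′-All (⟦0⟧ f (λ _ → refl)) (λ _ ≡0 → ≡0) λ {g} {h} _ _ →
    trans (linear f (F g) (- F h) h g) (lem (F g) (F h))
    where
    lem : ∀ a b → a * b + - b * a ≡ 0ℤ
    lem = solve-∀

  pairˡ : ∀ {g Q} → Pos g → Span Neg Q → Span (_∈ G′) (λ i → F g * Q i + - F Q * g i)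
  pairˡ {g} {Q} g∈ (nil Q≡0) = nil λ i →
    trans (cong₂ (λ x y → F g * x + - y * g i) (Q≡0 i) (⟦0⟧ f Q≡0)) (lem (F g) (g i))
    where
    lem : ∀ a b → a * 0ℤ + - 0ℤ * b ≡ 0ℤ
    lem = solve-∀
  pairˡ {g} {Q} g∈ (cons {h} {Q′} h∈ c Q≡) = cons (pair-∈ g∈ h∈) (pairˡ g∈ c) λ i →
    trans (cong₂ (λ x y → F g * x + - y * g i) (Q≡ i) (trans (⟦⟧-cong f Q≡) (⟦+⟧ f h Q′)))
          (lem (F g) (h i) (Q′ i) (F h) (F Q′) (g i))
    where
    lem : ∀ a x x′ y y′ b → a * (x + x′) + - (y + y′) * b ≡ (a * x + - y * b) + (a * x′ + - y′ * b)
    lem = solve-∀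

  -- The expression is bilinear in `P` and `Q`, so it expands into the same expression for pairs of
  -- generators, each of which is a member of `G′`. `pairˡ` expands the second argument, the
  -- recursion here the first.
  pairs : ∀ {P Q} → Span Pos P → Span Neg Q → Span (_∈ G′) (λ i → F P * Q i + - F Q * P i)
  pairs {P} {Q} (nil P≡0) _ = nil λ i →
    trans (cong₂ (λ x y → x * Q i + - F Q * y) (⟦0⟧ f P≡0) (P≡0 i)) (lem (F Q) (Q i))
    where
    lem : ∀ a b → 0ℤ * b + - a * 0ℤ ≡ 0ℤ
    lem = solve-∀
  pairs {P} {Q} (cons {g} {P′} g∈ c P≡) d = Span-cong
    (λ i → sym (trans (cong₂ (λ x y → y * Q i + - F Q * x) (P≡ i) (trans (⟦⟧-cong f P≡) (⟦+⟧ f g P′)))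
                      (lem (F g) (F P′) (Q i) (F Q) (g i) (P′ i))))
    (Span-+ (pairˡ g∈ d) (pairs c d))
    where
    lem : ∀ y y′ q a x x′ → (y + y′) * q + - a * (x + x′) ≡ (y * q + - a * x) + (y′ * q + - a * x′)
    lem = solve-∀

  record Split (z : I → ℤ) : Set where
    constructor split
    field
      {zeros poss negs} : I → ℤ
      zeros-span : Span (_∈ G′) zeros
      poss-span  : Span Pos poss
      negs-span  : Span Neg negs
      z≗         : ∀ i → z i ≡ zeros i + (poss i + negs i)

  splitting : ∀ {z} → Span (_∈ G) z → Split z
  splitting (nil z≡0) = split (nil λ _ → refl) (nil λ _ → refl) (nil λ _ → refl) z≡0
  splitting {z} (cons {g} {y} g∈G c z≡) with splitting c | <-cmp 0ℤ (F g)
  ... | split {Z} {P} {Q} cZ cP cQ y≡ | tri≈ _ 0≡ _ =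
    split (cons (single-∈ g∈G (sym 0≡)) cZ λ _ → refl) cP cQ λ i →
      trans (z≡ i) (trans (cong (λ x → g i + x) (y≡ i)) (sym (+-assoc (g i) (Z i) (P i + Q i))))
  ... | split {Z} {P} {Q} cZ cP cQ y≡ | tri< 0< _ _ =
    split cZ (cons (g∈G , 0<) cP λ _ → refl) cQ λ i →
      trans (z≡ i) (trans (cong (λ x → g i + x) (y≡ i)) (lem (g i) (Z i) (P i) (Q i)))
    where
    lem : ∀ a b c d → a + (b + (c + d)) ≡ b + ((a + c) + d)
    lem = solve-∀
  ... | split {Z} {P} {Q} cZ cP cQ y≡ | tri> _ _ <0 =
    split cZ cP (cons (g∈G , neg-mono-< <0) cQ λ _ → refl) λ i →
      trans (z≡ i) (trans (cong (λ x → g i + x) (y≡ i)) (lem (g i) (Z i) (P i) (Q i)))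
    where
    lem : ∀ a b c d → a + (b + (c + d)) ≡ b + (c + (a + d))
    lem = solve-∀

  -- Group the summands by the sign of `F`, so that z = Z + P + Q. From F z = 0 follows F P = - F Q,
  -- hence F P * z = F P * Z + (F P * Q - F Q * P), and the bracket is a sum of pairs.
  generate : ∀ {z} → Span (_∈ G) z → F z ≡ 0ℤ → ∃ λ D → Span (_∈ G′) (λ i → + suc D * z i)
  generate {z} c Fz≡0 with splitting c
  ... | split {Z} {P} {Q} cZ cP cQ z≡ = by-cases (Span-positive f proj₂ cP) (Span-positive (negate f) proj₂ cQ)
    where
    FP+FQ≡0 : F P + F Q ≡ 0ℤ
    FP+FQ≡0 = begin
      F P + F Q               ≡⟨ +-identityˡ _ ⟨
      0ℤ + (F P + F Q)        ≡⟨ cong₂ _+_ (Span-kernel f (All.lookup kernel) cZ) (⟦+⟧ f P Q) ⟨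
      F Z + F (λ i → P i + Q i) ≡⟨ ⟦+⟧ f Z _ ⟨
      F (λ i → Z i + (P i + Q i)) ≡⟨ ⟦⟧-cong f z≡ ⟨
      F z                     ≡⟨ Fz≡0 ⟩
      0ℤ                      ∎
      where open ≡-Reasoning

    -FQ≡FP : - F Q ≡ F P
    -FQ≡FP = trans (lem (F P) (F Q)) (trans (cong (λ x → F P - x) FP+FQ≡0) (+-identityʳ (F P)))
      where
      lem : ∀ a b → - b ≡ a - (a + b)
      lem = solve-∀

    scaled : 0ℤ < F P → ∃ λ D → Span (_∈ G′) (λ i → + suc D * z i)
    scaled 0<FP with F P in FP≡
    scaled (+<+ ()) | + zero
    -- The multiplier is the value `F P` itself, written as a successor because it is positive.
    ... | + suc D = D , Span-cong lemma (Span-+ (Span-* (suc D) cZ) (pairs cP cQ))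
      where
      lemma : ∀ i → + suc D * Z i + (F P * Q i + - F Q * P i) ≡ + suc D * z i
      lemma i = begin
        + suc D * Z i + (F P * Q i + - F Q * P i)
          ≡⟨ cong₂ (λ x y → + suc D * Z i + (x * Q i + y * P i)) FP≡ (trans -FQ≡FP FP≡) ⟩
        + suc D * Z i + (+ suc D * Q i + + suc D * P i) ≡⟨ alg (+ suc D) (Z i) (Q i) (P i) ⟩
        + suc D * (Z i + (P i + Q i)) ≡⟨ cong (+ suc D *_) (z≡ i) ⟨
        + suc D * z i ∎
        where
        open ≡-Reasoning
        alg : ∀ s a b c → s * a + (s * b + s * c) ≡ s * (a + (c + b))
        alg = solve-∀

    by-cases : (∀ i → P i ≡ 0ℤ) ⊎ 0ℤ < F P → (∀ i → Q i ≡ 0ℤ) ⊎ 0ℤ < - F Q →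
               ∃ λ D → Span (_∈ G′) (λ i → + suc D * z i)
    by-cases (inj₂ 0<FP) _           = scaled 0<FP
    -- Since - F Q = F P, positivity on either side suffices; no separate refutation is needed.
    by-cases (inj₁ _)   (inj₂ 0<-FQ) = scaled (subst (0ℤ <_) -FQ≡FP 0<-FQ)
    by-cases (inj₁ P≡0) (inj₁ Q≡0)   = 0 , Span-cong
      (λ i → sym (trans (*-identityˡ (z i)) (trans (z≡ i)
        (trans (cong (λ x → Z i + x) (cong₂ _+_ (P≡0 i) (Q≡0 i))) (+-identityʳ (Z i))))))
      cZ

-- The list generates the solutions only as a rational cone: an integral solution is reached after
-- multiplication by some positive `suc D`, which may depend on that solution.
record Generators {I : Set} (G₀ : List (I → ℤ)) (fs : List (Linear I)) : Set where
  field
    gens     : List (I → ℤ)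
    nonNeg   : All NonNeg gens
    solution : All (λ f → All (λ g → ⟦ f ⟧ g ≡ 0ℤ) gens) fs
    complete : ∀ {z} → Span (_∈ G₀) z → All (λ f → ⟦ f ⟧ z ≡ 0ℤ) fs →
               ∃ λ D → Span (_∈ gens) (λ i → + suc D * z i)

generators : {I : Set} (G₀ : List (I → ℤ)) → All NonNeg G₀ → ∀ fs → Generators G₀ fs
generators G₀ G₀≥0 [] = record
  { gens = G₀ ; nonNeg = G₀≥0 ; solution = []
  ; complete = λ c _ → 0 , Span-cong (λ i → sym (*-identityˡ _)) c }
generators G₀ G₀≥0 (f ∷ fs) = record
  { gens     = G′
  ; nonNeg   = G′-All (λ _ → ≤-refl) (λ g∈ _ → All.lookup nonNeg g∈) λ (g∈ , 0<g) (h∈ , 0<h) i →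
      0≤+ (0≤* (<⇒≤ 0<g) (All.lookup nonNeg h∈ i)) (0≤* (<⇒≤ 0<h) (All.lookup nonNeg g∈ i))
  ; solution = kernel ∷ All.map (λ {f′} → solution′ f′) solution
  ; complete = complete′
  }
  where
  open Generators (generators G₀ G₀≥0 fs)
  open Intersect f gens

  solution′ : ∀ f′ → All (λ g → ⟦ f′ ⟧ g ≡ 0ℤ) gens → All (λ g → ⟦ f′ ⟧ g ≡ 0ℤ) G′
  solution′ f′ sol = G′-All (⟦0⟧ f′ (λ _ → refl)) (λ g∈ _ → All.lookup sol g∈) λ {g} {h} (g∈ , _) (h∈ , _) →
    trans (linear f′ (F g) (- F h) h g)
      (trans (cong₂ (λ x y → F g * x + - F h * y) (All.lookup sol h∈) (All.lookup sol g∈)) (lem (F g) (F h)))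
    where
    lem : ∀ a b → a * 0ℤ + - b * 0ℤ ≡ 0ℤ
    lem = solve-∀

  complete′ : ∀ {z} → Span (_∈ G₀) z → All (λ f → ⟦ f ⟧ z ≡ 0ℤ) (f ∷ fs) →
              ∃ λ D → Span (_∈ G′) (λ i → + suc D * z i)
  complete′ {z} c (fz≡0 ∷ fsz≡0) with complete c fsz≡0
  ... | D , c₁ with generate c₁ (trans (⟦*⟧ f (+ suc D) z) (trans (cong (+ suc D *_) fz≡0) (*-zeroʳ (+ suc D))))
  -- The successor of this witness is the product of the two multipliers.
  ... | D₁ , c₂ = D ℕ.+ D₁ ℕ.* suc D , Span-cong
        (λ i → trans (sym (*-assoc (+ suc D₁) (+ suc D) (z i))) (cong (_* z i) (sym (pos-* (suc D₁) (suc D))))) c₂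

-- Division with remainder in a finitely generated monoid

peel : ∀ {I : Set} {g} {G : List (I → ℤ)} {y} → Span (_∈ g ∷ G) y →
       ∃₂ λ n y′ → Span (_∈ G) y′ × (∀ i → y i ≡ + n * g i + y′ i)
peel (nil y≡0) = 0 , (λ _ → 0ℤ) , nil (λ _ → refl) , y≡0
peel {g = g} (cons {_} {y} (here refl) c z≡) with peel c
... | n , y′ , c′ , y≡ = suc n , y′ , c′ , λ i →
  trans (z≡ i) (trans (cong (λ x → g i + x) (y≡ i))
    (trans (sym (+-assoc (g i) (+ n * g i) (y′ i))) (cong (_+ y′ i) (sym (suc-* (+ n) (g i))))))
peel {g = g} (cons {h} {y} (there h∈) c z≡) with peel c
... | n , y′ , c′ , y≡ = n , (λ i → h i + y′ i) , cons h∈ c′ (λ _ → refl) , λ i →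
  trans (z≡ i) (trans (cong (λ x → h i + x) (y≡ i)) (lem (h i) (+ n * g i) (y′ i)))
  where
  lem : ∀ a b c → a + (b + c) ≡ b + (a + c)
  lem = solve-∀

total : {I : Set} → List (I → ℤ) → I → ℤ
total []      i = 0ℤ
total (g ∷ G) i = g i + total G i

total-nonNeg : {I : Set} {G : List (I → ℤ)} → All NonNeg G → NonNeg (total G)
total-nonNeg []          i = ≤-refl
total-nonNeg (g≥0 ∷ G≥0) i = 0≤+ (g≥0 i) (total-nonNeg G≥0 i)

*-monoʳ : ∀ {a b c} → 0ℤ ≤ c → a ≤ b → a * c ≤ b * c
*-monoʳ {c = c} 0≤c = *-monoʳ-≤-nonNeg c {{nonNegative 0≤c}}

-- Collect the uses of each generator into one coefficient with `peel` and divide that coefficient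
-- by `E`. The quotients form `Q`, again a member of the monoid; the remainders are at most `E`, so
-- `R` is bounded independently of `y`.
divide : ∀ {I : Set} {G : List (I → ℤ)} → All NonNeg G → ∀ E .{{_ : ℕ.NonZero E}} {y} → Span (_∈ G) y →
         ∃₂ λ Q R → Span (_∈ G) Q × (∀ i → y i ≡ + E * Q i + R i) × NonNeg R × (∀ i → R i ≤ + E * total G i)
divide [] E (nil y≡0) = (λ _ → 0ℤ) , (λ _ → 0ℤ) , nil (λ _ → refl) ,
  (λ i → trans (y≡0 i) (sym (zero-sum E))) , (λ _ → ≤-refl) , λ _ → ≤-reflexive (sym (*-zeroʳ (+ E)))
  where
  zero-sum : ∀ E → + E * 0ℤ + 0ℤ ≡ 0ℤ
  zero-sum E = trans (+-identityʳ _) (*-zeroʳ (+ E))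
divide {G = g ∷ G} (g≥0 ∷ G≥0) E {y} c with peel c
... | n , y′ , c′ , y≡ with divide G≥0 E c′
... | Q , R , cQ , y′≡ , R≥0 , R≤ =
  (λ i → + q * g i + Q i) , (λ i → + r * g i + R i) ,
  Span-+ (Span-* q (Span-gen (here refl))) (Span-map there cQ) ,
  (λ i → trans (y≡ i) (trans (cong₂ (λ a b → a * g i + b) n≡ (y′≡ i)) (lem (+ r) (+ q) (+ E) (g i) (Q i) (R i)))) ,
  (λ i → 0≤+ (0≤* {+ r} (+≤+ ℕ.z≤n) (g≥0 i)) (R≥0 i)) ,
  λ i → ≤-trans (+-mono-≤ (*-monoʳ (g≥0 i) (+≤+ (ℕ.m%n≤n n E))) (R≤ i))
    (≤-reflexive (sym (*-distribˡ-+ (+ E) (g i) (total G i))))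
  where
  q r : ℕ
  q = n ℕ./ E
  r = n ℕ.% E
  n≡ : + n ≡ + r + + q * + E
  n≡ = trans (cong +_ (ℕ.m≡m%n+[m/n]*n n E)) (trans (pos-+ r (q ℕ.* E)) (cong (λ x → + r + x) (pos-* q E)))
  lem : ∀ r q e g Q R → (r + q * e) * g + (e * Q + R) ≡ e * (q * g + Q) + (r * g + R)
  lem = solve-∀

-- Proximity of rational and integral solutions

unit : ∀ {k} → Fin k → Fin k → ℤ
unit zero    zero    = 1ℤ
unit zero    (suc j) = 0ℤ
unit (suc i) zero    = 0ℤ
unit (suc i) (suc j) = unit i j

unit-nonNeg : ∀ {k} (i : Fin k) → NonNeg (unit i)
unit-nonNeg zero    zero    = +≤+ ℕ.z≤n
unit-nonNeg zero    (suc j) = ≤-refl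
unit-nonNeg (suc i) zero    = ≤-refl
unit-nonNeg (suc i) (suc j) = unit-nonNeg i j

dot : ∀ {k} → (Fin k → ℤ) → (Fin k → ℤ) → ℤ
dot u r = sum (λ i → u i * r i)

dot-cong : ∀ {k} {u w : Fin k → ℤ} → u ≗ w → ∀ r → dot u r ≡ dot w r
dot-cong u≗w r = sum-cong-≗ (λ i → cong (_* r i) (u≗w i))

dot-linear : ∀ {k} a b (u w r : Fin k → ℤ) → dot (λ i → a * u i + b * w i) r ≡ a * dot u r + b * dot w r
dot-linear {zero}  a b u w r = sym (cong₂ _+_ (*-zeroʳ a) (*-zeroʳ b))
dot-linear {suc k} a b u w r = trans
  (cong (λ x → (a * u zero + b * w zero) * r zero + x) (dot-linear a b (u ∘ suc) (w ∘ suc) (r ∘ suc)))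
  (lem a b (u zero) (w zero) (r zero) (dot (u ∘ suc) (r ∘ suc)) (dot (w ∘ suc) (r ∘ suc)))
  where
  lem : ∀ a b u w r x y → (a * u + b * w) * r + (a * x + b * y) ≡ a * (u * r + x) + b * (w * r + y)
  lem = solve-∀

dot-comm : ∀ {k} (u w : Fin k → ℤ) → dot u w ≡ dot w u
dot-comm u w = sum-cong-≗ (λ i → *-comm (u i) (w i))

dot-0 : ∀ {k} (u : Fin k → ℤ) → dot u (λ _ → 0ℤ) ≡ 0ℤ
dot-0 {zero} u = refl
dot-0 {suc k} u = trans (cong₂ _+_ (*-zeroʳ (u zero)) (dot-0 (u ∘ suc))) refl

dot-unit : ∀ {k} (u : Fin k → ℤ) x → dot u (λ i → unit i x) ≡ u x
dot-unit u zero    = trans (cong₂ _+_ (*-identityʳ (u zero)) (dot-0 (u ∘ suc))) (+-identityʳ (u zero))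
dot-unit u (suc x) = trans (cong₂ _+_ (*-zeroʳ (u zero)) (dot-unit (u ∘ suc) x)) (+-identityˡ (u (suc x)))

dot-scale : ∀ {k} a (u r : Fin k → ℤ) → dot (λ i → a * u i) r ≡ a * dot u r
dot-scale a u r = begin
  dot (λ i → a * u i) r             ≡⟨ dot-cong (λ i → +-identityʳ (a * u i)) r ⟨
  dot (λ i → a * u i + 0ℤ * u i) r  ≡⟨ dot-linear a 0ℤ u u r ⟩
  a * dot u r + 0ℤ                  ≡⟨ +-identityʳ (a * dot u r) ⟩
  a * dot u r                       ∎
  where open ≡-Reasoning

dot-unitˡ : ∀ {k} x (u : Fin k → ℤ) → dot (unit x) u ≡ u x
dot-unitˡ zero    u = trans
  (cong₂ _+_ (*-identityˡ (u zero)) (trans (dot-comm _ (u ∘ suc)) (dot-0 (u ∘ suc))))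
  (+-identityʳ (u zero))
dot-unitˡ (suc x) u = trans (cong (λ y → 0ℤ + y) (dot-unitˡ x (u ∘ suc))) (+-identityˡ (u (suc x)))

Span-sum : ∀ {I : Set} {S : (I → ℤ) → Set} {k} {h : Fin k → I → ℤ} →
           (∀ i → Span S (h i)) → Span S (λ x → sum (λ i → h i x))
Span-sum {k = zero}  hs = nil (λ _ → refl)
Span-sum {k = suc k} hs = Span-+ (hs zero) (Span-sum (hs ∘ suc))

module _ {k : ℕ} where

  -- The index set of a pair (p, q) of coefficient families; `inj₁` marks p and `inj₂` marks q.
  Two : Set
  Two = Fin k ⊎ Fin k

  unitˡ unitʳ : Fin k → Two → ℤ
  unitˡ i = [ unit i , (λ _ → 0ℤ) ]′
  unitʳ i = [ (λ _ → 0ℤ) , unit i ]′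

  units : List (Two → ℤ)
  units = L.tabulate unitˡ ++ L.tabulate unitʳ

  units-nonNeg : All NonNeg units
  units-nonNeg = All.++⁺
    (All.tabulate⁺ λ { i (inj₁ x) → unit-nonNeg i x ; i (inj₂ x) → ≤-refl })
    (All.tabulate⁺ λ { i (inj₁ x) → ≤-refl ; i (inj₂ x) → unit-nonNeg i x })

  units-span : ∀ {y} → NonNeg y → Span (_∈ units) y
  units-span {y} y≥0 = Span-cong (λ { (inj₁ x) → eqˡ x ; (inj₂ x) → eqʳ x })
    (Span-+ (Span-sum λ i → Span-* ∣ y (inj₁ i) ∣ (Span-gen (∈-++⁺ˡ (∈-tabulate⁺ i))))
            (Span-sum λ i → Span-* ∣ y (inj₂ i) ∣ (Span-gen (∈-++⁺ʳ (L.tabulate unitˡ) (∈-tabulate⁺ i)))))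
    where
    abs : Two → ℤ
    abs i = + ∣ y i ∣
    eqˡ : ∀ x → dot (abs ∘ inj₁) (λ i → unit i x) + dot (abs ∘ inj₂) (λ _ → 0ℤ) ≡ y (inj₁ x)
    eqˡ x = trans (cong₂ _+_ (dot-unit (abs ∘ inj₁) x) (dot-0 (abs ∘ inj₂)))
                  (trans (+-identityʳ _) (0≤i⇒+∣i∣≡i (y≥0 (inj₁ x))))
    eqʳ : ∀ x → dot (abs ∘ inj₁) (λ _ → 0ℤ) + dot (abs ∘ inj₂) (λ i → unit i x) ≡ y (inj₂ x)
    eqʳ x = trans (cong₂ _+_ (dot-0 (abs ∘ inj₁)) (dot-unit (abs ∘ inj₂) x))
                  (trans (+-identityˡ _) (0≤i⇒+∣i∣≡i (y≥0 (inj₂ x))))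

  difference : (Fin k → ℤ) → Linear Two
  difference r = record
    { ⟦_⟧     = λ y → dot (y ∘ inj₁) r - dot (y ∘ inj₂) r
    ; ⟦⟧-cong = λ u≗w → cong₂ _-_ (dot-cong (u≗w ∘ inj₁) r) (dot-cong (u≗w ∘ inj₂) r)
    ; linear  = λ a b u w → trans
        (cong₂ _-_ (dot-linear a b (u ∘ inj₁) (w ∘ inj₁) r) (dot-linear a b (u ∘ inj₂) (w ∘ inj₂) r))
        (lem a b (dot (u ∘ inj₁) r) (dot (w ∘ inj₁) r) (dot (u ∘ inj₂) r) (dot (w ∘ inj₂) r))
    }
    where
    lem : ∀ a b x y z t → a * x + b * y - (a * z + b * t) ≡ a * (x - z) + b * (y - t)
    lem = solve-∀

abstract
  -- With d = `suc D`, the pair (p, d m) solves the system that equates the two combinations of `X`.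
  -- Some multiple e (p, d m) is a sum of generators, and division by e d gives an integral solution
  -- `Q` of the same system. Its left half is at most p / d and its right half differs from m by at
  -- most the total of the generators, which depends on `X` alone.
  proximity : ∀ {k n} (X : Fin k → Fin n → ℤ) → ∃ λ (B : Fin k → ℤ) → NonNeg B ×
    (∀ D {p m} → NonNeg p → NonNeg m →
      (∀ j → dot p (λ i → X i j) ≡ + suc D * dot m (λ i → X i j)) →
      ∃ λ m′ → NonNeg m′ × (∀ j → dot m′ (λ i → X i j) ≡ dot m (λ i → X i j)) ×
               (∀ i → + suc D * m′ i ≤ p i + + suc D * B i))
  proximity {k} {n} X = (λ i → total gens (inj₂ i)) , (λ i → total-nonNeg nonNeg (inj₂ i)) , near
    where
    open Generators (generators (units {k}) units-nonNeg (L.tabulate (λ j → difference (λ i → X i j))))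

    near : ∀ D {p m} → NonNeg p → NonNeg m →
      (∀ j → dot p (λ i → X i j) ≡ + suc D * dot m (λ i → X i j)) →
      ∃ λ m′ → NonNeg m′ × (∀ j → dot m′ (λ i → X i j) ≡ dot m (λ i → X i j)) ×
               (∀ i → + suc D * m′ i ≤ p i + + suc D * total gens (inj₂ i))
    near D {p} {m} p≥0 m≥0 eq
      with complete (units-span {y = [ p , (λ i → + suc D * m i) ]′}
             λ { (inj₁ i) → p≥0 i ; (inj₂ i) → 0≤* {+ suc D} (+≤+ ℕ.z≤n) (m≥0 i) })
             (All.tabulate⁺ λ j → i≡j⇒i-j≡0 (trans (eq j) (sym (dot-scale (+ suc D) m (λ i → X i j)))))
    ... | D₁ , c with divide nonNeg (suc D₁ ℕ.* suc D) c
    ... | Q , R , cQ , y≡ , R≥0 , R≤ = m′ , m′≥0 , m′-dot , m′≤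
      where
      open ≤-Reasoning

      d e : ℤ
      d = + suc D
      e = + suc D₁

      -- Both halves of `Q` represent the same vector, so exchanging the right half, contained in
      -- `m`, for the left half keeps the represented vector.
      m′ : Fin k → ℤ
      m′ i = (m i - Q (inj₂ i)) + Q (inj₁ i)

      ed≡ : + (suc D₁ ℕ.* suc D) ≡ e * d
      ed≡ = pos-* (suc D₁) (suc D)

      Q≥0 : NonNeg Q
      Q≥0 = Span-nonNeg (All.lookup nonNeg) cQ

      -- The right half of the divided vector is e d m, a multiple of the divisor. This gives both
      -- the sign and the size of what `Q` leaves of `m`.
      remainder₂ : ∀ i → (e * d) * (m i - Q (inj₂ i)) ≡ R (inj₂ i)
      remainder₂ i = begin-equality
        (e * d) * (m i - Q (inj₂ i))             ≡⟨ alg₁ e d (m i) (Q (inj₂ i)) ⟩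
        e * (d * m i) - (e * d) * Q (inj₂ i)     ≡⟨ cong (_- (e * d) * Q (inj₂ i)) (y≡ (inj₂ i)) ⟩
        + (suc D₁ ℕ.* suc D) * Q (inj₂ i) + R (inj₂ i) - (e * d) * Q (inj₂ i)
                                                 ≡⟨ cong (λ x → x * Q (inj₂ i) + R (inj₂ i) - (e * d) * Q (inj₂ i)) ed≡ ⟩
        (e * d) * Q (inj₂ i) + R (inj₂ i) - (e * d) * Q (inj₂ i) ≡⟨ alg₂ (e * d * Q (inj₂ i)) (R (inj₂ i)) ⟩
        R (inj₂ i)                               ∎
        where
        alg₁ : ∀ e d m q → (e * d) * (m - q) ≡ e * (d * m) - (e * d) * q
        alg₁ = solve-∀
        alg₂ : ∀ a b → a + b - a ≡ b
        alg₂ = solve-∀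

      m′≥0 : NonNeg m′
      m′≥0 i = 0≤+ (*-cancelˡ-≤-pos 0ℤ (m i - Q (inj₂ i)) (+ (suc D₁ ℕ.* suc D)) (begin
        + (suc D₁ ℕ.* suc D) * 0ℤ      ≡⟨ *-zeroʳ (+ (suc D₁ ℕ.* suc D)) ⟩
        0ℤ                             ≤⟨ R≥0 (inj₂ i) ⟩
        R (inj₂ i)                     ≡⟨ remainder₂ i ⟨
        (e * d) * (m i - Q (inj₂ i))   ≡⟨ cong (_* (m i - Q (inj₂ i))) ed≡ ⟨
        + (suc D₁ ℕ.* suc D) * (m i - Q (inj₂ i)) ∎)) (Q≥0 (inj₁ i))

      m′-dot : ∀ j → dot m′ (λ i → X i j) ≡ dot m (λ i → X i j)
      m′-dot j = begin-equality
        dot m′ r                                    ≡⟨ dot-cong (λ i → alg (m i) (Q (inj₂ i)) (Q (inj₁ i))) r ⟩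
        dot (λ i → 1ℤ * m i + 1ℤ * (1ℤ * Q (inj₁ i) + - 1ℤ * Q (inj₂ i))) r
                                                    ≡⟨ dot-linear 1ℤ 1ℤ m _ r ⟩
        1ℤ * dot m r + 1ℤ * dot (λ i → 1ℤ * Q (inj₁ i) + - 1ℤ * Q (inj₂ i)) r
                                                    ≡⟨ cong (λ x → 1ℤ * dot m r + 1ℤ * x)
                                                            (dot-linear 1ℤ (- 1ℤ) (Q ∘ inj₁) (Q ∘ inj₂) r) ⟩
        1ℤ * dot m r + 1ℤ * (1ℤ * dot (Q ∘ inj₁) r + - 1ℤ * dot (Q ∘ inj₂) r)
                                                    ≡⟨ alg (dot m r) (dot (Q ∘ inj₂) r) (dot (Q ∘ inj₁) r) ⟨
        (dot m r - dot (Q ∘ inj₂) r) + dot (Q ∘ inj₁) r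
                                                    ≡⟨ alg₂ (dot m r) _ _ ⟩
        dot m r + (dot (Q ∘ inj₁) r - dot (Q ∘ inj₂) r)
                                                    ≡⟨ cong (λ x → dot m r + x) kernel ⟩
        dot m r + 0ℤ                                ≡⟨ +-identityʳ _ ⟩
        dot m r                                     ∎
        where
        r : Fin k → ℤ
        r i = X i j
        kernel : dot (Q ∘ inj₁) r - dot (Q ∘ inj₂) r ≡ 0ℤ
        kernel = Span-kernel (difference r) (All.lookup (All.tabulate⁻ solution j)) cQ
        alg : ∀ m q q′ → (m - q) + q′ ≡ 1ℤ * m + 1ℤ * (1ℤ * q′ + - 1ℤ * q)
        alg = solve-∀
        alg₂ : ∀ m q q′ → (m - q) + q′ ≡ m + (q′ - q)
        alg₂ = solve-∀

      m′≤ : ∀ i → d * m′ i ≤ p i + d * total gens (inj₂ i)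
      m′≤ i = *-cancelˡ-≤-pos _ _ e (begin
        e * (d * ((m i - Q (inj₂ i)) + Q (inj₁ i)))            ≡⟨ alg₁ e d (m i - Q (inj₂ i)) (Q (inj₁ i)) ⟩
        (e * d) * (m i - Q (inj₂ i)) + (e * d) * Q (inj₁ i)    ≡⟨ cong₂ (λ x y → x + y * Q (inj₁ i)) (remainder₂ i) (sym ed≡) ⟩
        R (inj₂ i) + E * Q (inj₁ i)                            ≤⟨ +-mono-≤ (R≤ (inj₂ i)) (i≤i+0≤ (R≥0 (inj₁ i))) ⟩
        E * total gens (inj₂ i) + (E * Q (inj₁ i) + R (inj₁ i))
                                                             ≡⟨ cong₂ (λ x y → x * total gens (inj₂ i) + y) ed≡ (sym (y≡ (inj₁ i))) ⟩
        (e * d) * total gens (inj₂ i) + e * p i                ≡⟨ alg₂ e d (total gens (inj₂ i)) (p i) ⟩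
        e * (p i + d * total gens (inj₂ i))                    ∎)
        where
        E : ℤ
        E = + (suc D₁ ℕ.* suc D)
        i≤i+0≤ : ∀ {a b} → 0ℤ ≤ b → a ≤ a + b
        i≤i+0≤ {a} 0≤b = subst (_≤ a + _) (+-identityʳ a) (+-monoʳ-≤ a 0≤b)
        alg₁ : ∀ e d x q → e * (d * (x + q)) ≡ (e * d) * x + (e * d) * q
        alg₁ = solve-∀
        alg₂ : ∀ e d t p → (e * d) * t + e * p ≡ e * (p + d * t)
        alg₂ = solve-∀

-- Points, combinations and sumsets in coordinates

lookup-ext : ∀ {A : Set} {n} {u w : Vec A n} → (∀ j → lookup u j ≡ lookup w j) → u ≡ w
lookup-ext {u = u} {w} eq = trans (sym (V.tabulate∘lookup u)) (trans (V.tabulate-cong eq) (V.tabulate∘lookup w))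

module _ {n : ℕ} (j : Fin n) where

  lookup-+v : ∀ u w → lookup (u +v w) j ≡ lookup u j + lookup w j
  lookup-+v = V.lookup-zipWith _+_ j

  lookup--v : ∀ u w → lookup (u -v w) j ≡ lookup u j - lookup w j
  lookup--v = V.lookup-zipWith _-_ j

  lookup-·v : ∀ c u → lookup (c ·v u) j ≡ c * lookup u j
  lookup-·v c = V.lookup-map j (c *_)

  lookup-0v : lookup 0v j ≡ 0ℤ
  lookup-0v = V.lookup-replicate j 0ℤ

size : ∀ {k} → (Fin k → ℤ) → ℤ
size u = dot u (λ _ → 1ℤ)

column : ∀ {n} (X : List (Pt n)) → Fin n → Fin (L.length X) → ℤ
column X j i = lookup (L.lookup X i) j

coeff : ∀ {k} → Vec ℕ k → Fin k → ℤ
coeff ns i = + lookup ns i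

lookup-lincombℕ : ∀ {n} (X : List (Pt n)) ns j → lookup (lincombℕ X ns) j ≡ dot (coeff ns) (column X j)
lookup-lincombℕ []      []       j = lookup-0v j
lookup-lincombℕ (x ∷ X) (c ∷ ns) j = trans (lookup-+v j ((+ c) ·v x) _)
  (cong₂ _+_ (lookup-·v j (+ c) x) (lookup-lincombℕ X ns j))

toVec : ∀ {k} → (Fin k → ℤ) → Vec ℕ k
toVec u = V.tabulate (∣_∣ ∘ u)

coeff-toVec : ∀ {k} {u : Fin k → ℤ} → NonNeg u → coeff (toVec u) ≗ u
coeff-toVec {u = u} u≥0 i = trans (cong +_ (V.lookup∘tabulate (∣_∣ ∘ u) i)) (0≤i⇒+∣i∣≡i (u≥0 i))

lincombℕ-toVec : ∀ {n} (X : List (Pt n)) {u} → NonNeg u →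
                 ∀ j → lookup (lincombℕ X (toVec u)) j ≡ dot u (column X j)
lincombℕ-toVec X {u} u≥0 j = trans (lookup-lincombℕ X (toVec u) j) (dot-cong (coeff-toVec u≥0) (column X j))

coeff-nonNeg : ∀ {k} (ns : Vec ℕ k) → NonNeg (coeff ns)
coeff-nonNeg ns i = +≤+ ℕ.z≤n

size-coeff : ∀ {k} (ns : Vec ℕ k) → size (coeff ns) ≡ + V.sum ns
size-coeff []       = refl
size-coeff (c ∷ ns) = trans (cong₂ _+_ (*-identityʳ (+ c)) (size-coeff ns)) (sym (pos-+ c (V.sum ns)))

Semigrp⁺ : ∀ {n} (X : List (Pt n)) {v u} → NonNeg u → (∀ j → dot u (column X j) ≡ lookup v j) → Semigrp X v
Semigrp⁺ X {u = u} u≥0 eq = toVec u , lookup-ext λ j → trans (lincombℕ-toVec X u≥0 j) (eq j)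

Semigrp⁻ : ∀ {n} (X : List (Pt n)) {v} → Semigrp X v → ∃ λ u → NonNeg u × ∀ j → dot u (column X j) ≡ lookup v j
Semigrp⁻ X (ns , eq) = coeff ns , coeff-nonNeg ns , λ j →
  trans (sym (lookup-lincombℕ X ns j)) (cong (λ w → lookup w j) eq)

module _ {n} (f : Pt n → Pt n) (A : List (Pt n)) where

  -- Mapping preserves the length only up to a propositional equality, so positions are carried
  -- along by a cast.
  ι : Fin (L.length (L.map f A)) → Fin (L.length A)
  ι = Fin.cast (L.length-map f A)

  ι⁻¹ : Fin (L.length A) → Fin (L.length (L.map f A))
  ι⁻¹ = Fin.cast (sym (L.length-map f A))

dot-map : ∀ {n} (f : Pt n → Pt n) A u j →
          dot (u ∘ ι f A) (column (L.map f A) j) ≡ dot u (λ i → lookup (f (L.lookup A i)) j)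
dot-map f []      u j = refl
dot-map f (x ∷ A) u j = cong (λ y → u zero * lookup (f x) j + y) (dot-map f A (u ∘ suc) j)

dot-map⁻¹ : ∀ {n} (f : Pt n → Pt n) A u j →
            dot (u ∘ ι⁻¹ f A) (λ i → lookup (f (L.lookup A i)) j) ≡ dot u (column (L.map f A) j)
dot-map⁻¹ f A u j = trans (sym (dot-map f A (u ∘ ι⁻¹ f A) j))
  (dot-cong (λ i → cong u (Fin.cast-involutive (sym (L.length-map f A)) (L.length-map f A) i)) _)

-- Sumsets as coefficient families of given size

SumSet? : ∀ {n} N (A : List (Pt n)) v → Dec (SumSet N A v)
SumSet? zero    A v = Dec.map′ (λ eq → [] , [] , eq) (λ { ([] , [] , eq) → eq }) (V.≡-dec _≟_ 0v v)
-- Every member of the finite list is tried as the first summand.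
SumSet? (suc N) A v = Dec.map′ join split (Any.any? (λ a → SumSet? N A (v -v a)) A)
  where
  join : Any.Any (λ a → SumSet N A (v -v a)) A → SumSet (suc N) A v
  join p with find p
  ... | a , a∈ , as , as∈ , eq = a ∷ as , a∈ ∷ as∈ , lookup-ext λ j →
    trans (lookup-+v j a (sumv as)) (trans (cong (λ w → lookup a j + lookup w j) eq)
      (trans (cong (λ x → lookup a j + x) (lookup--v j v a)) (alg (lookup a j) (lookup v j))))
    where
    alg : ∀ a v → a + (v - a) ≡ v
    alg = solve-∀
  split : SumSet (suc N) A v → Any.Any (λ a → SumSet N A (v -v a)) A
  split (a ∷ as , a∈ ∷ as∈ , eq) = Any.map (λ { refl → as , as∈ , lookup-ext λ j → sym
    (trans (lookup--v j v a) (trans (cong (λ w → lookup w j - lookup a j) (sym eq))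
      (trans (cong (_- lookup a j) (lookup-+v j a (sumv as))) (alg (lookup a j) (lookup (sumv as) j))))) }) a∈
    where
    alg : ∀ a s → (a + s) - a ≡ s
    alg = solve-∀

-- The family counts how often each position of `A` is used: every summand adds a unit vector at the
-- position where its membership proof finds it.
SumSet⁻ : ∀ {n} N (A : List (Pt n)) {v} → SumSet N A v →
          ∃ λ u → NonNeg u × size u ≡ + N × ∀ j → dot u (column A j) ≡ lookup v j
SumSet⁻ zero A ([] , [] , refl) = (λ _ → 0ℤ) , (λ _ → ≤-refl) , zeros (λ _ → 1ℤ) ,
  λ j → trans (zeros (column A j)) (sym (lookup-0v j))
  where
  zeros : ∀ r → dot (λ _ → 0ℤ) r ≡ 0ℤ
  zeros r = trans (dot-comm _ r) (dot-0 r)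
SumSet⁻ (suc N) A (a ∷ as , a∈ ∷ as∈ , refl) with SumSet⁻ N A (as , as∈ , refl)
... | u , u≥0 , size≡ , u≡ = (λ i → 1ℤ * unit i₀ i + 1ℤ * u i) ,
  (λ i → 0≤+ (0≤* {1ℤ} (+≤+ ℕ.z≤n) (unit-nonNeg i₀ i)) (0≤* {1ℤ} (+≤+ ℕ.z≤n) (u≥0 i))) ,
  trans (extend (λ _ → 1ℤ)) (cong (λ x → 1ℤ + x) size≡) ,
  λ j → trans (extend (column A j)) (trans (cong₂ _+_ (cong (λ x → lookup x j) (sym (Any.lookup-index a∈))) (u≡ j))
    (sym (lookup-+v j a (sumv as))))
  where
  i₀ : Fin (L.length A)
  i₀ = index a∈
  extend : ∀ r → dot (λ i → 1ℤ * unit i₀ i + 1ℤ * u i) r ≡ r i₀ + dot u r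
  extend r = trans (dot-linear 1ℤ 1ℤ (unit i₀) u r)
    (cong₂ _+_ (trans (*-identityˡ _) (dot-unitˡ i₀ r)) (*-identityˡ _))

SumSet-replicate : ∀ {n} {A : List (Pt n)} {x} → x ∈ A → ∀ c {M w} →
                   SumSet M A w → SumSet (c ℕ.+ M) A (((+ c) ·v x) +v w)
SumSet-replicate {x = x} x∈ zero {w = w} (as , as∈ , eq) = as , as∈ , trans eq (lookup-ext λ j →
  sym (trans (lookup-+v j (0ℤ ·v x) w) (trans (cong (_+ lookup w j) (lookup-·v j 0ℤ x)) (+-identityˡ (lookup w j)))))
SumSet-replicate {x = x} x∈ (suc c) {w = w} s with SumSet-replicate x∈ c s
... | as , as∈ , eq = x ∷ as , x∈ ∷ as∈ , lookup-ext λ j → begin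
  lookup (x +v sumv as) j                    ≡⟨ lookup-+v j x (sumv as) ⟩
  lookup x j + lookup (sumv as) j            ≡⟨ cong (λ y → lookup x j + lookup y j) eq ⟩
  lookup x j + lookup (((+ c) ·v x) +v w) j    ≡⟨ cong (λ y → lookup x j + y) (trans (lookup-+v j ((+ c) ·v x) w)
                                                       (cong (_+ lookup w j) (lookup-·v j (+ c) x))) ⟩
  lookup x j + (+ c * lookup x j + lookup w j) ≡⟨ +-assoc (lookup x j) (+ c * lookup x j) (lookup w j) ⟨
  lookup x j + + c * lookup x j + lookup w j ≡⟨ cong (_+ lookup w j) (trans (lookup-·v j (+ suc c) x) (suc-* (+ c) (lookup x j))) ⟨
  lookup ((+ suc c) ·v x) j + lookup w j       ≡⟨ lookup-+v j ((+ suc c) ·v x) w ⟨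
  lookup (((+ suc c) ·v x) +v w) j             ∎
  where open ≡-Reasoning

SumSet-lincombℕ : ∀ {n} {A : List (Pt n)} X → All (_∈ A) X → ∀ ns → SumSet (V.sum ns) A (lincombℕ X ns)
SumSet-lincombℕ []      []        []       = [] , [] , refl
SumSet-lincombℕ (x ∷ X) (x∈ ∷ X∈) (c ∷ ns) = SumSet-replicate x∈ c (SumSet-lincombℕ X X∈ ns)

SumSet⁺ : ∀ {n} {N} (A : List (Pt n)) {v u} → NonNeg u → size u ≡ + N →
          (∀ j → dot u (column A j) ≡ lookup v j) → SumSet N A v
SumSet⁺ {N = N} A {v} {u} u≥0 size≡ u≡ = subst₂ (λ M w → SumSet M A w) sum≡ (proj₂ (Semigrp⁺ A u≥0 u≡))
  (SumSet-lincombℕ A (All.tabulate (λ x∈ → x∈)) (toVec u))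
  where
  sum≡ : V.sum (toVec u) ≡ N
  sum≡ = +-injective (trans (sym (size-coeff (toVec u))) (trans (dot-cong (coeff-toVec u≥0) _) size≡))

-- Clearing denominators

-- `toℚ` normalises through a gcd that is stuck on a variable; rewriting to the explicit reduced
-- fraction lets the rational operations compute.
toℚ≡mkℚ : ∀ z → toℚ z ≡ mkℚ z 0 (Coprime.sym (1-coprimeTo ∣ z ∣))
toℚ≡mkℚ z = ℚ.↥p/↧p≡p (mkℚ z 0 (Coprime.sym (1-coprimeTo ∣ z ∣)))

toℚ-+ : ∀ a b → toℚ (a + b) ≡ toℚ a ℚ.+ toℚ b
toℚ-+ a b rewrite toℚ≡mkℚ a | toℚ≡mkℚ b = cong toℚ (sym (cong₂ _+_ (*-identityʳ a) (*-identityʳ b)))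

toℚ-* : ∀ a b → toℚ (a * b) ≡ toℚ a ℚ.* toℚ b
toℚ-* a b rewrite toℚ≡mkℚ a | toℚ≡mkℚ b = refl

toℚ-injective : ∀ {a b} → toℚ a ≡ toℚ b → a ≡ b
toℚ-injective {a} {b} eq = cong ℚ.↥_ (trans (sym (toℚ≡mkℚ a)) (trans eq (toℚ≡mkℚ b)))

toℚ-nonNeg : ∀ m → 0ℚ ℚ.≤ toℚ (+ m)
toℚ-nonNeg m rewrite toℚ≡mkℚ (+ m) = ℚ.nonNegative⁻¹ _

toℚ-↧ : ∀ p → toℚ (ℚ.↧ p) ℚ.* p ≡ toℚ (ℚ.↥ p)
toℚ-↧ p@(mkℚ m d _) = ℚ.toℚᵘ-injective (ℚᵘ.≃-trans (ℚ.toℚᵘ-homo-* (toℚ (ℚ.↧ p)) p)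
  (subst₂ (λ a b → ℚ.toℚᵘ a ℚᵘ.* ℚ.toℚᵘ p ℚᵘ.≃ ℚ.toℚᵘ b) (sym (toℚ≡mkℚ (ℚ.↧ p))) (sym (toℚ≡mkℚ (ℚ.↥ p)))
    (ℚᵘ.*≡* (trans (*-identityʳ (+ suc d * m))
      (trans (*-comm (+ suc d) m) (cong (λ x → m * + x) (sym (ℕ.*-identityˡ (suc d)))))))))

-- The rational 1 / (D + 1); the shift keeps the denominator positive.
recip : ℕ → ℚ
recip D = mkℚ (+ 1) D (1-coprimeTo (suc D))

recip-inverse : ∀ D → recip D ℚ.* toℚ (+ suc D) ≡ 1ℚ
recip-inverse D = trans (ℚ.*-comm (recip D) (toℚ (+ suc D))) (toℚ-↧ (recip D))

fromℕs : ∀ {k} → Vec ℕ k → Vec ℚ k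
fromℕs = V.map (toℚ ∘ +_)

module _ {n : ℕ} where

  toℚv-+ : (u w : Pt n) → toℚv (u +v w) ≡ toℚv u +q toℚv w
  toℚv-+ u w = lookup-ext λ j → begin
    lookup (toℚv (u +v w)) j             ≡⟨ V.lookup-map j toℚ (u +v w) ⟩
    toℚ (lookup (u +v w) j)              ≡⟨ cong toℚ (lookup-+v j u w) ⟩
    toℚ (lookup u j + lookup w j)        ≡⟨ toℚ-+ (lookup u j) (lookup w j) ⟩
    toℚ (lookup u j) ℚ.+ toℚ (lookup w j) ≡⟨ cong₂ ℚ._+_ (V.lookup-map j toℚ u) (V.lookup-map j toℚ w) ⟨
    lookup (toℚv u) j ℚ.+ lookup (toℚv w) j ≡⟨ V.lookup-zipWith ℚ._+_ j (toℚv u) (toℚv w) ⟨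
    lookup (toℚv u +q toℚv w) j          ∎
    where open ≡-Reasoning

  toℚv-· : ∀ c (u : Pt n) → toℚv (c ·v u) ≡ toℚ c ·q toℚv u
  toℚv-· c u = trans (sym (V.map-∘ toℚ (c *_) u)) (trans (V.map-cong (toℚ-* c) u) (V.map-∘ (toℚ c ℚ.*_) toℚ u))

  toℚv-injective : {u w : Pt n} → toℚv u ≡ toℚv w → u ≡ w
  toℚv-injective {u} {w} eq = lookup-ext λ j → toℚ-injective
    (trans (sym (V.lookup-map j toℚ u)) (trans (cong (λ x → lookup x j) eq) (V.lookup-map j toℚ w)))

  ·q-assoc : ∀ r s (u : PtQ n) → (r ℚ.* s) ·q u ≡ r ·q (s ·q u)
  ·q-assoc r s u = trans (V.map-cong (ℚ.*-assoc r s) u) (V.map-∘ (r ℚ.*_) (s ℚ.*_) u)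

  ·q-identity : (u : PtQ n) → 1ℚ ·q u ≡ u
  ·q-identity u = trans (V.map-cong ℚ.*-identityˡ u) (V.map-id u)

  ·q-distrib : ∀ r (u w : PtQ n) → r ·q (u +q w) ≡ (r ·q u) +q (r ·q w)
  ·q-distrib r u w = lookup-ext λ j → begin
    lookup (r ·q (u +q w)) j                  ≡⟨ V.lookup-map j (r ℚ.*_) (u +q w) ⟩
    r ℚ.* lookup (u +q w) j                   ≡⟨ cong (r ℚ.*_) (V.lookup-zipWith ℚ._+_ j u w) ⟩
    r ℚ.* (lookup u j ℚ.+ lookup w j)         ≡⟨ ℚ.*-distribˡ-+ r (lookup u j) (lookup w j) ⟩
    r ℚ.* lookup u j ℚ.+ r ℚ.* lookup w j     ≡⟨ cong₂ ℚ._+_ (V.lookup-map j (r ℚ.*_) u) (V.lookup-map j (r ℚ.*_) w) ⟨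
    lookup (r ·q u) j ℚ.+ lookup (r ·q w) j   ≡⟨ V.lookup-zipWith ℚ._+_ j (r ·q u) (r ·q w) ⟨
    lookup ((r ·q u) +q (r ·q w)) j           ∎
    where open ≡-Reasoning

  lincombℚ-scale : ∀ r (X : List (Pt n)) cs → lincombℚ X (V.map (r ℚ.*_) cs) ≡ r ·q lincombℚ X cs
  lincombℚ-scale r []      []       = lookup-ext λ j → begin
    lookup 0q j         ≡⟨ V.lookup-replicate j 0ℚ ⟩
    0ℚ                  ≡⟨ ℚ.*-zeroʳ r ⟨
    r ℚ.* 0ℚ            ≡⟨ cong (r ℚ.*_) (V.lookup-replicate j 0ℚ) ⟨
    r ℚ.* lookup 0q j   ≡⟨ V.lookup-map j (r ℚ.*_) 0q ⟨
    lookup (r ·q 0q) j  ∎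
    where open ≡-Reasoning
  lincombℚ-scale r (x ∷ X) (c ∷ cs) = trans
    (cong₂ _+q_ (·q-assoc r c (toℚv x)) (lincombℚ-scale r X cs))
    (sym (·q-distrib r (c ·q toℚv x) (lincombℚ X cs)))

  lincombℚ-fromℕs : ∀ (X : List (Pt n)) ns → lincombℚ X (fromℕs ns) ≡ toℚv (lincombℕ X ns)
  lincombℚ-fromℕs []      []       = sym (V.map-replicate toℚ 0ℤ n)
  lincombℚ-fromℕs (x ∷ X) (c ∷ ns) = trans
    (cong₂ _+q_ (sym (toℚv-· (+ c) x)) (lincombℚ-fromℕs X ns))
    (sym (toℚv-+ ((+ c) ·v x) (lincombℕ X ns)))

sumℚ-scale : ∀ {k} r (cs : Vec ℚ k) → sumℚ (V.map (r ℚ.*_) cs) ≡ r ℚ.* sumℚ cs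
sumℚ-scale r []       = sym (ℚ.*-zeroʳ r)
sumℚ-scale r (c ∷ cs) = trans (cong (r ℚ.* c ℚ.+_) (sumℚ-scale r cs)) (sym (ℚ.*-distribˡ-+ r c (sumℚ cs)))

sumℚ-fromℕs : ∀ {k} (ns : Vec ℕ k) → sumℚ (fromℕs ns) ≡ toℚ (+ V.sum ns)
sumℚ-fromℕs []       = refl
sumℚ-fromℕs (c ∷ ns) = trans (cong (toℚ (+ c) ℚ.+_) (sumℚ-fromℕs ns))
  (sym (trans (cong toℚ (pos-+ c (V.sum ns))) (toℚ-+ (+ c) (+ V.sum ns))))

divided-nonneg : ∀ {k} D (ns : Vec ℕ k) → Nonneg (V.map (recip D ℚ.*_) (fromℕs ns))
divided-nonneg D []       = []
divided-nonneg D (c ∷ ns) = ℚ.nonNegative⁻¹ _ {{quotient≥0}} ∷ divided-nonneg D ns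
  where
  quotient≥0 : ℚ.NonNegative (recip D ℚ.* toℚ (+ c))
  quotient≥0 = ℚ.nonNeg*nonNeg⇒nonNeg (recip D) (toℚ (+ c)) {{ℚ.nonNegative (toℚ-nonNeg c)}}

lincombℚ-divided : ∀ {n} D (X : List (Pt n)) ns →
                   lincombℚ X (V.map (recip D ℚ.*_) (fromℕs ns)) ≡ recip D ·q toℚv (lincombℕ X ns)
lincombℚ-divided D X ns = trans (lincombℚ-scale (recip D) X (fromℕs ns)) (cong (recip D ·q_) (lincombℚ-fromℕs X ns))

Cone⁺ : ∀ {n} D (X : List (Pt n)) {v u} → NonNeg u →
        (∀ j → dot u (column X j) ≡ + suc D * lookup v j) → Cone X v
Cone⁺ D X {v} {u} u≥0 eq = V.map (recip D ℚ.*_) (fromℕs (toVec u)) , divided-nonneg D (toVec u) , (begin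
  lincombℚ X (V.map (recip D ℚ.*_) (fromℕs (toVec u))) ≡⟨ lincombℚ-divided D X (toVec u) ⟩
  recip D ·q toℚv (lincombℕ X (toVec u))           ≡⟨ cong (λ w → recip D ·q toℚv w) (lookup-ext λ j →
                                                        trans (lincombℕ-toVec X u≥0 j) (trans (eq j) (sym (lookup-·v j (+ suc D) v)))) ⟩
  recip D ·q toℚv ((+ suc D) ·v v)                   ≡⟨ cong (recip D ·q_) (toℚv-· (+ suc D) v) ⟩
  recip D ·q (toℚ (+ suc D) ·q toℚv v)             ≡⟨ ·q-assoc (recip D) (toℚ (+ suc D)) (toℚv v) ⟨
  (recip D ℚ.* toℚ (+ suc D)) ·q toℚv v            ≡⟨ cong (_·q toℚv v) (recip-inverse D) ⟩
  1ℚ ·q toℚv v                                     ≡⟨ ·q-identity (toℚv v) ⟩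
  toℚv v                                           ∎)
  where open ≡-Reasoning

NHull⁺ : ∀ {n} N (A : List (Pt n)) {v u} → NonNeg u → size u ≡ + suc N →
         (∀ j → dot u (column A j) ≡ lookup v j) → NHull (suc N) A v
NHull⁺ N A {v} {u} u≥0 size≡ eq = V.map (recip N ℚ.*_) (fromℕs ns) , divided-nonneg N ns ,
  trans (sumℚ-scale (recip N) (fromℕs ns))
    (trans (cong (recip N ℚ.*_) (trans (sumℚ-fromℕs ns) (cong toℚ sum≡))) (recip-inverse N)) ,
  sym (begin
    toℚ (+ suc N) ·q lincombℚ A (V.map (recip N ℚ.*_) (fromℕs ns)) ≡⟨ cong (toℚ (+ suc N) ·q_) (lincombℚ-divided N A ns) ⟩
    toℚ (+ suc N) ·q (recip N ·q toℚv (lincombℕ A ns))         ≡⟨ ·q-assoc (toℚ (+ suc N)) (recip N) _ ⟨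
    (toℚ (+ suc N) ℚ.* recip N) ·q toℚv (lincombℕ A ns)        ≡⟨ cong (_·q toℚv (lincombℕ A ns))
                                                                       (trans (ℚ.*-comm (toℚ (+ suc N)) (recip N)) (recip-inverse N)) ⟩
    1ℚ ·q toℚv (lincombℕ A ns)                                 ≡⟨ ·q-identity _ ⟩
    toℚv (lincombℕ A ns)                                       ≡⟨ cong toℚv (proj₂ (Semigrp⁺ A u≥0 eq)) ⟩
    toℚv v                                                     ∎)
  where
  open ≡-Reasoning
  ns : Vec ℕ _
  ns = toVec u
  sum≡ : + V.sum ns ≡ + suc N
  sum≡ = trans (sym (size-coeff ns)) (trans (dot-cong (coeff-toVec u≥0) _) size≡)

-- The denominators are multiplied together one by one, each earlier numerator being rescaled.
-- Nonnegativity makes the numerators natural numbers.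
commonDenominator : ∀ {k} {cs : Vec ℚ k} → Nonneg cs → ∃₂ λ D ns → V.map (toℚ (+ suc D) ℚ.*_) cs ≡ fromℕs ns
commonDenominator [] = 0 , [] , refl
commonDenominator {cs = q@(mkℚ m d _) ∷ cs} (0≤c ∷ 0≤cs) with commonDenominator 0≤cs
... | D , ns , eq = D ℕ.+ d ℕ.* suc D , (suc D ℕ.* ∣ m ∣) ∷ V.map (suc d ℕ.*_) ns , cong₂ _∷_ head≡ tail≡
  where
  open ≡-Reasoning
  denom : toℚ (+ (suc d ℕ.* suc D)) ≡ toℚ (+ suc d) ℚ.* toℚ (+ suc D)
  denom = trans (cong toℚ (pos-* (suc d) (suc D))) (toℚ-* (+ suc d) (+ suc D))
  m≥0 : + ∣ m ∣ ≡ m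
  m≥0 = 0≤i⇒+∣i∣≡i (nonNegative⁻¹ m {{ℚ.nonNegative 0≤c}})
  head≡ : toℚ (+ (suc d ℕ.* suc D)) ℚ.* q ≡ toℚ (+ (suc D ℕ.* ∣ m ∣))
  head≡ = begin
    toℚ (+ (suc d ℕ.* suc D)) ℚ.* q              ≡⟨ cong (ℚ._* q) (trans denom (ℚ.*-comm (toℚ (+ suc d)) _)) ⟩
    (toℚ (+ suc D) ℚ.* toℚ (+ suc d)) ℚ.* q      ≡⟨ ℚ.*-assoc (toℚ (+ suc D)) _ _ ⟩
    toℚ (+ suc D) ℚ.* (toℚ (+ suc d) ℚ.* q)      ≡⟨ cong (toℚ (+ suc D) ℚ.*_) (toℚ-↧ q) ⟩
    toℚ (+ suc D) ℚ.* toℚ m                              ≡⟨ toℚ-* (+ suc D) m ⟨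
    toℚ (+ suc D * m)                                    ≡⟨ cong (λ x → toℚ (+ suc D * x)) m≥0 ⟨
    toℚ (+ suc D * + ∣ m ∣)                              ≡⟨ cong toℚ (pos-* (suc D) ∣ m ∣) ⟨
    toℚ (+ (suc D ℕ.* ∣ m ∣))                            ∎
  tail≡ : V.map (toℚ (+ (suc d ℕ.* suc D)) ℚ.*_) cs ≡ fromℕs (V.map (suc d ℕ.*_) ns)
  tail≡ = begin
    toℚ (+ (suc d ℕ.* suc D)) ·q cs                      ≡⟨ cong (_·q cs) denom ⟩
    (toℚ (+ suc d) ℚ.* toℚ (+ suc D)) ·q cs              ≡⟨ ·q-assoc (toℚ (+ suc d)) (toℚ (+ suc D)) cs ⟩
    toℚ (+ suc d) ·q (toℚ (+ suc D) ·q cs)               ≡⟨ cong (toℚ (+ suc d) ·q_) eq ⟩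
    toℚ (+ suc d) ·q fromℕs ns                           ≡⟨ V.map-∘ (toℚ (+ suc d) ℚ.*_) (toℚ ∘ +_) ns ⟨
    V.map (λ x → toℚ (+ suc d) ℚ.* toℚ (+ x)) ns         ≡⟨ V.map-cong (λ x → sym (trans (cong toℚ (pos-* (suc d) x))
                                                                                   (toℚ-* (+ suc d) (+ x)))) ns ⟩
    V.map (λ x → toℚ (+ (suc d ℕ.* x))) ns               ≡⟨ V.map-∘ (toℚ ∘ +_) (suc d ℕ.*_) ns ⟩
    fromℕs (V.map (suc d ℕ.*_) ns)                       ∎

NHull⁻ : ∀ {n} N (A : List (Pt n)) {v} → NHull N A v → ∃₂ λ D u → NonNeg u × size u ≡ + suc D ×
         ∀ j → + N * dot u (column A j) ≡ + suc D * lookup v j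
NHull⁻ N A {v} (cs , cs≥0 , sum≡1 , v≡) with commonDenominator cs≥0
... | D , ns , eq = D , coeff ns , coeff-nonNeg ns , trans (size-coeff ns) (toℚ-injective size≡) ,
  λ j → trans (cong (+ N *_) (sym (lookup-lincombℕ A ns j))) (trans (sym (lookup-·v j (+ N) (lincombℕ A ns)))
    (trans (cong (λ w → lookup w j) (toℚv-injective points≡)) (lookup-·v j (+ suc D) v)))
  where
  open ≡-Reasoning
  size≡ : toℚ (+ V.sum ns) ≡ toℚ (+ suc D)
  size≡ = begin
    toℚ (+ V.sum ns)                           ≡⟨ sumℚ-fromℕs ns ⟨
    sumℚ (fromℕs ns)                           ≡⟨ cong sumℚ eq ⟨
    sumℚ (V.map (toℚ (+ suc D) ℚ.*_) cs)       ≡⟨ sumℚ-scale (toℚ (+ suc D)) cs ⟩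
    toℚ (+ suc D) ℚ.* sumℚ cs                  ≡⟨ cong (toℚ (+ suc D) ℚ.*_) sum≡1 ⟩
    toℚ (+ suc D) ℚ.* 1ℚ                       ≡⟨ ℚ.*-identityʳ _ ⟩
    toℚ (+ suc D)                              ∎
  points≡ : toℚv ((+ N) ·v lincombℕ A ns) ≡ toℚv ((+ suc D) ·v v)
  points≡ = begin
    toℚv ((+ N) ·v lincombℕ A ns)                     ≡⟨ toℚv-· (+ N) _ ⟩
    toℚ (+ N) ·q toℚv (lincombℕ A ns)               ≡⟨ cong (toℚ (+ N) ·q_) (lincombℚ-fromℕs A ns) ⟨
    toℚ (+ N) ·q lincombℚ A (fromℕs ns)             ≡⟨ cong (λ x → toℚ (+ N) ·q lincombℚ A x) eq ⟨
    toℚ (+ N) ·q lincombℚ A (V.map (toℚ (+ suc D) ℚ.*_) cs) ≡⟨ cong (toℚ (+ N) ·q_) (lincombℚ-scale (toℚ (+ suc D)) A cs) ⟩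
    toℚ (+ N) ·q (toℚ (+ suc D) ·q lincombℚ A cs)   ≡⟨ ·q-assoc (toℚ (+ N)) (toℚ (+ suc D)) _ ⟨
    (toℚ (+ N) ℚ.* toℚ (+ suc D)) ·q lincombℚ A cs  ≡⟨ cong (_·q lincombℚ A cs) (ℚ.*-comm (toℚ (+ N)) _) ⟩
    (toℚ (+ suc D) ℚ.* toℚ (+ N)) ·q lincombℚ A cs  ≡⟨ ·q-assoc (toℚ (+ suc D)) (toℚ (+ N)) _ ⟩
    toℚ (+ suc D) ·q (toℚ (+ N) ·q lincombℚ A cs)   ≡⟨ cong (toℚ (+ suc D) ·q_) v≡ ⟨
    toℚ (+ suc D) ·q toℚv v                         ≡⟨ toℚv-· (+ suc D) v ⟨
    toℚv ((+ suc D) ·v v)                             ∎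

-- Reflection in a point of large weight

dot-const : ∀ {k} (u : Fin k → ℤ) c (r : Fin k → ℤ) → dot u (λ i → c - r i) ≡ c * size u - dot u r
dot-const {zero}  u c r = sym (trans (+-identityʳ _) (*-zeroʳ c))
dot-const {suc k} u c r = trans (cong (λ x → u zero * (c - r zero) + x) (dot-const (u ∘ suc) c (r ∘ suc)))
  (alg (u zero) c (r zero) (size (u ∘ suc)) (dot (u ∘ suc) (r ∘ suc)))
  where
  alg : ∀ u c r s d → u * (c - r) + (c * s - d) ≡ c * (u * 1ℤ + s) - (u * r + d)
  alg = solve-∀

size-nonNeg : ∀ {k} {u : Fin k → ℤ} → NonNeg u → 0ℤ ≤ size u
size-nonNeg {zero}  u≥0 = ≤-refl
size-nonNeg {suc k} {u} u≥0 = 0≤+ (subst (0ℤ ≤_) (sym (*-identityʳ (u zero))) (u≥0 zero)) (size-nonNeg (u≥0 ∘ suc))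

term≤size : ∀ {k} {u : Fin k → ℤ} → NonNeg u → ∀ i → u i ≤ size u
term≤size {u = u} u≥0 zero = begin
  u zero                          ≡⟨ *-identityʳ (u zero) ⟨
  u zero * 1ℤ                     ≡⟨ +-identityʳ (u zero * 1ℤ) ⟨
  u zero * 1ℤ + 0ℤ                ≤⟨ +-monoʳ-≤ (u zero * 1ℤ) (size-nonNeg (u≥0 ∘ suc)) ⟩
  u zero * 1ℤ + size (u ∘ suc)    ∎
  where open ≤-Reasoning
term≤size {u = u} u≥0 (suc i) = begin
  u (suc i)                       ≤⟨ term≤size (u≥0 ∘ suc) i ⟩
  size (u ∘ suc)                  ≡⟨ +-identityˡ _ ⟨
  0ℤ + size (u ∘ suc)             ≤⟨ +-monoˡ-≤ (size (u ∘ suc)) (subst (0ℤ ≤_) (sym (*-identityʳ (u zero))) (u≥0 zero)) ⟩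
  u zero * 1ℤ + size (u ∘ suc)    ∎
  where open ≤-Reasoning

-- A largest term is at least the average. The argument in `Fin k` witnesses that the family is
-- nonempty.
heavyTerm : ∀ {k} → Fin k → (u : Fin k → ℤ) → ∃ λ i → size u ≤ + k * u i
heavyTerm {suc zero} _ u = zero , ≤-reflexive (trans (+-identityʳ _) (*-comm (u zero) 1ℤ))
heavyTerm {suc (suc k)} _ u with heavyTerm zero (u ∘ suc)
... | i , size≤ with ≤-total (u zero) (u (suc i))
... | inj₁ u₀≤uᵢ = suc i , (begin
  u zero * 1ℤ + size (u ∘ suc)              ≤⟨ +-mono-≤ (≤-trans (≤-reflexive (*-identityʳ (u zero))) u₀≤uᵢ) size≤ ⟩
  u (suc i) + + suc k * u (suc i)           ≡⟨ suc-* (+ suc k) (u (suc i)) ⟨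
  + suc (suc k) * u (suc i)                 ∎)
  where open ≤-Reasoning
... | inj₂ uᵢ≤u₀ = zero , (begin
  u zero * 1ℤ + size (u ∘ suc)              ≤⟨ +-mono-≤ (≤-reflexive (*-identityʳ (u zero)))
                                                         (≤-trans size≤ (*-monoˡ-≤-nonNeg (+ suc k) uᵢ≤u₀)) ⟩
  u zero + + suc k * u zero                 ≡⟨ suc-* (+ suc k) (u zero) ⟨
  + suc (suc k) * u zero                    ∎)
  where open ≤-Reasoning

unit-adjust-nonNeg : ∀ {k} {u : Fin k → ℤ} {δ} i → NonNeg u → 0ℤ ≤ u i + δ → NonNeg (λ x → 1ℤ * u x + δ * unit i x)
unit-adjust-nonNeg {u = u} {δ} zero u≥0 0≤ zero =
  subst (0ℤ ≤_) (sym (cong₂ _+_ (*-identityˡ (u zero)) (*-identityʳ δ))) 0≤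
unit-adjust-nonNeg {u = u} {δ} zero u≥0 0≤ (suc x) =
  0≤+ (0≤* {1ℤ} (+≤+ ℕ.z≤n) (u≥0 (suc x))) (≤-reflexive (sym (*-zeroʳ δ)))
unit-adjust-nonNeg {u = u} {δ} (suc i) u≥0 0≤ zero =
  0≤+ (0≤* {1ℤ} (+≤+ ℕ.z≤n) (u≥0 zero)) (≤-reflexive (sym (*-zeroʳ δ)))
unit-adjust-nonNeg (suc i) u≥0 0≤ (suc x) = unit-adjust-nonNeg i (u≥0 ∘ suc) 0≤ x

-- Summed over x ≠ i, the bounds on `m` give at most N - N uᵢ / d + β with d = `suc D`. The heavy
-- weight frees N uᵢ / d ≥ N / k ≥ β, which absorbs the error β.
rest-bound : ∀ {k N D β} {u b m : Fin k → ℤ} i → NonNeg b → size u ≡ + suc D → + suc D ≤ + k * u i →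
             size b ≤ β → + k * β ≤ + N → (∀ x → + suc D * m x ≤ + N * u x + + suc D * b x) →
             size m - m i ≤ + N
rest-bound {suc k} {N} {D} {β} {u} {b} {m} i b≥0 size-u heavy size-b kβ≤N m≤ =
  *-cancelˡ-≤-pos _ _ (+ suc k) (*-cancelˡ-≤-pos _ _ (+ suc D) (0≤i-j⇒j≤i (begin
    0ℤ
      ≤⟨ 0≤+ (0≤+ (0≤+ (0≤* {K} (+≤+ ℕ.z≤n) (i≤j⇒0≤j-i (term≤size t≥0 i)))
                       (0≤* {+ N} (+≤+ ℕ.z≤n) (i≤j⇒0≤j-i heavy)))
                  (0≤* {K * d} (0≤* {K} {d} (+≤+ ℕ.z≤n) (+≤+ ℕ.z≤n)) (0≤+ (b≥0 i) (i≤j⇒0≤j-i size-b))))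
             (0≤* {d} (+≤+ ℕ.z≤n) (i≤j⇒0≤j-i kβ≤N)) ⟩
    ((K * (size t - t i) + + N * (K * u i - d)) + K * d * (b i + (β - size b))) + d * (+ N - K * β)
      ≡⟨ cong (λ s → ((K * (s - t i) + + N * (K * u i - d)) + K * d * (b i + (β - size b))) + d * (+ N - K * β)) size-t ⟩
    ((K * ((+ N * d + d * size b - d * size m) - t i) + + N * (K * u i - d)) + K * d * (b i + (β - size b)))
      + d * (+ N - K * β)
      ≡⟨ alg K (+ N) d (size b) (size m) (u i) (b i) (m i) β ⟩
    d * (K * + N) - d * (K * (size m - m i)) ∎)))
  where
  open ≤-Reasoning
  d K : ℤ
  d = + suc D
  K = + suc k
  t : Fin (suc k) → ℤ
  t x = (+ N * u x + d * b x) - d * m x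
  t≥0 : NonNeg t
  t≥0 x = i≤j⇒0≤j-i (m≤ x)
  size-t : size t ≡ + N * d + d * size b - d * size m
  size-t = begin-equality
    size t                                         ≡⟨ dot-cong (λ x → shape (y x) d (m x)) one ⟩
    size (λ x → 1ℤ * y x + (- d) * m x)            ≡⟨ dot-linear 1ℤ (- d) y m one ⟩
    1ℤ * size y + (- d) * size m                   ≡⟨ shape (size y) d (size m) ⟨
    size y - d * size m                            ≡⟨ cong (_- d * size m) (dot-linear (+ N) d u b one) ⟩
    + N * size u + d * size b - d * size m         ≡⟨ cong (λ s → + N * s + d * size b - d * size m) size-u ⟩
    + N * d + d * size b - d * size m              ∎
    where
    one y : Fin (suc k) → ℤ
    one _ = 1ℤ
    y x = + N * u x + d * b x
    shape : ∀ a d m → a - d * m ≡ 1ℤ * a + (- d) * m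
    shape = solve-∀
  alg : ∀ K N d B M u b m β →
    ((K * ((N * d + d * B - d * M) - (N * u + d * b - d * m)) + N * (K * u - d)) + K * d * (b + (β - B))) + d * (N - K * β)
    ≡ d * (K * N) - d * (K * (M - m))
  alg = solve-∀

lookup-reflection : ∀ {n} N (a v : Pt n) j → lookup ((N ·v a) -v v) j ≡ N * lookup a j - lookup v j
lookup-reflection N a v j = trans (lookup--v j (N ·v a) v) (cong (_- lookup v j) (lookup-·v j N a))

-- The structure of N-fold sumsets for large N

module _ {n : ℕ} (A : List (Pt n)) where

  k : ℕ
  k = L.length A

  point : Fin k → Pt n
  point = L.lookup A

  reflected : Fin k → Fin k → Fin n → ℤ
  reflected i x j = lookup (point i -v point x) j

  dot-reflected : ∀ i u j → dot u (λ x → reflected i x j) ≡ lookup (point i) j * size u - dot u (column A j)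
  dot-reflected i u j = trans
    (trans (dot-comm u _) (trans (dot-cong (λ x → lookup--v j (point i) (point x)) u) (dot-comm _ u)))
    (dot-const u (lookup (point i) j) (column A j))

  bound : Fin k → Fin k → ℤ
  bound i = proj₁ (proximity (reflected i))

  bound-nonNeg : ∀ i → NonNeg (bound i)
  bound-nonNeg i = proj₁ (proj₂ (proximity (reflected i)))

  -- Summing over all reflection points gives one number that dominates the total bound for each of
  -- them, whichever point turns out to be heavy.
  slack : ℤ
  slack = size (λ i → size (bound i))

  threshold : ℕ
  threshold = k ℕ.* ∣ slack ∣

  -- Only the coefficient at i can be too large for N summands; as point i - point i = 0
  -- it may be chosen freely, and it is chosen so that the coefficients sum up to N.
  rebalance : ∀ N {v} i {m′} → NonNeg m′ → size m′ - m′ i ≤ + N →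
              (∀ j → dot m′ (λ x → reflected i x j) ≡ + N * lookup (point i) j - lookup v j) → SumSet N A v
  rebalance N {v} i {m′} m′≥0 rest≤N eq = SumSet⁺ A
    (unit-adjust-nonNeg i m′≥0 (subst (0ℤ ≤_) (alg₁ (+ N) (size m′) (m′ i)) (i≤j⇒0≤j-i rest≤N)))
    (trans (adjusted (λ _ → 1ℤ)) (alg₂ (size m′) (+ N)))
    λ j → trans (adjusted (column A j)) (begin
      dot m′ (column A j) + δ * lookup (point i) j
        ≡⟨ alg₃ (dot m′ (column A j)) (+ N) (size m′) (lookup (point i) j) ⟩
      + N * lookup (point i) j - (lookup (point i) j * size m′ - dot m′ (column A j))
        ≡⟨ cong (λ x → + N * lookup (point i) j - x) (trans (sym (dot-reflected i m′ j)) (eq j)) ⟩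
      + N * lookup (point i) j - (+ N * lookup (point i) j - lookup v j)
        ≡⟨ alg₄ (+ N * lookup (point i) j) (lookup v j) ⟩
      lookup v j ∎)
    where
    open ≡-Reasoning
    δ : ℤ
    δ = + N - size m′
    adjusted : ∀ r → dot (λ x → 1ℤ * m′ x + δ * unit i x) r ≡ dot m′ r + δ * r i
    adjusted r = trans (dot-linear 1ℤ δ m′ (unit i) r)
      (cong₂ (λ x y → x + δ * y) (*-identityˡ (dot m′ r)) (dot-unitˡ i r))
    alg₁ : ∀ N s m → N - (s - m) ≡ m + (N - s)
    alg₁ = solve-∀
    alg₂ : ∀ s N → s + (N - s) * 1ℤ ≡ N
    alg₂ = solve-∀
    alg₃ : ∀ d N s a → d + (N - s) * a ≡ N * a - (a * s - d)
    alg₃ = solve-∀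
    alg₄ : ∀ a v → a - (a - v) ≡ v
    alg₄ = solve-∀

  -- With v = Σ uₓ x and Σ uₓ equal to the number of summands, the same coefficients represent v
  -- over `A` and the reflection of v over a - A for every a in `A`. So neither point can be
  -- exceptional.
  sumset⇒ : ∀ {N v} → SumSet (suc N) A v → NHull (suc N) A v × ¬ ExcN (suc N) A v
  sumset⇒ {N} {v} s with SumSet⁻ (suc N) A s
  ... | u , u≥0 , size≡ , u≡ = NHull⁺ N A u≥0 size≡ u≡ , λ
    { (inj₁ (_ , ∉P)) → ∉P (Semigrp⁺ A u≥0 u≡)
    ; (inj₂ (a , a∈ , w , (_ , ∉P) , v≡)) → ∉P (Semigrp⁺ (a −set A) (u≥0 ∘ ι (a -v_) A) λ j → begin
        dot (u ∘ ι (a -v_) A) (column (a −set A) j)     ≡⟨ dot-map (a -v_) A u j ⟩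
        dot u (λ x → lookup (a -v point x) j)           ≡⟨ cong (λ b → dot u (λ x → lookup (b -v point x) j)) (Any.lookup-index a∈) ⟩
        dot u (λ x → reflected (index a∈) x j)          ≡⟨ dot-reflected (index a∈) u j ⟩
        lookup (point (index a∈)) j * size u - dot u (column A j)
          ≡⟨ cong₂ (λ b s → lookup b j * s - dot u (column A j)) (sym (Any.lookup-index a∈)) size≡ ⟩
        lookup a j * + suc N - dot u (column A j)       ≡⟨ cong (λ x → lookup a j * + suc N - x)
                                                             (trans (u≡ j) (trans (cong (λ x → lookup x j) v≡)
                                                               (lookup-reflection (+ suc N) a w j))) ⟩
        lookup a j * + suc N - (+ suc N * lookup a j - lookup w j) ≡⟨ alg (lookup a j) (+ suc N) (lookup w j) ⟩
        lookup w j                                      ∎) }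
    where
    open ≡-Reasoning
    alg : ∀ a N w → a * N - (N * a - w) ≡ w
    alg = solve-∀

  -- The reflection w of v lies in the cone of a - A. Were v outside the sumset, w could not lie in
  -- the semigroup either, since a representation of w can be turned into N summands for v; then w
  -- would be exceptional.
  refill : ∀ {N v D u} i → threshold ℕ.≤ N → NonNeg u → size u ≡ + suc D → + suc D ≤ + k * u i →
           (∀ j → + N * dot u (column A j) ≡ + suc D * lookup v j) → ¬ ExcN N A v → SumSet N A v
  refill {N} {v} {D} {u} i N≥ u≥0 size-u heavy u≡ ∉Exc = decidable-stable (SumSet? N A v) λ ∉S →
    ∉Exc (inj₂ (a , ∈-lookup i , w , (cone , ∉S ∘ from-semigroup) , v≡))
    where
    a w : Pt n
    a = point i
    w = ((+ N) ·v a) -v v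

    v≡ : v ≡ ((+ N) ·v a) -v w
    v≡ = lookup-ext λ j → sym (trans (lookup-reflection (+ N) a w j)
      (trans (cong (λ x → + N * lookup a j - x) (lookup-reflection (+ N) a v j)) (alg (+ N * lookup a j) (lookup v j))))
      where
      alg : ∀ a v → a - (a - v) ≡ v
      alg = solve-∀

    Nu : Fin k → ℤ
    Nu x = + N * u x

    Nu≥0 : NonNeg Nu
    Nu≥0 x = 0≤* {+ N} (+≤+ ℕ.z≤n) (u≥0 x)

    Nu-reflected : ∀ j → dot Nu (λ x → reflected i x j) ≡ + suc D * lookup w j
    Nu-reflected j = begin
      dot Nu (λ x → reflected i x j)                             ≡⟨ dot-scale (+ N) u (λ x → reflected i x j) ⟩
      + N * dot u (λ x → reflected i x j)                        ≡⟨ cong (+ N *_) (dot-reflected i u j) ⟩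
      + N * (lookup a j * size u - dot u (column A j))           ≡⟨ alg (+ N) (lookup a j) (size u) (dot u (column A j)) ⟩
      size u * (+ N * lookup a j) - + N * dot u (column A j)     ≡⟨ cong₂ (λ s y → s * (+ N * lookup a j) - y) size-u (u≡ j) ⟩
      + suc D * (+ N * lookup a j) - + suc D * lookup v j        ≡⟨ alg₂ (+ suc D) (+ N * lookup a j) (lookup v j) ⟩
      + suc D * (+ N * lookup a j - lookup v j)                  ≡⟨ cong (+ suc D *_) (lookup-reflection (+ N) a v j) ⟨
      + suc D * lookup w j                                       ∎
      where
      open ≡-Reasoning
      alg : ∀ N a s d → N * (a * s - d) ≡ s * (N * a) - N * d
      alg = solve-∀
      alg₂ : ∀ D a v → D * a - D * v ≡ D * (a - v)
      alg₂ = solve-∀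

    slack≤ : + k * slack ≤ + N
    slack≤ = subst (_≤ + N)
      (trans (pos-* k ∣ slack ∣) (cong (+ k *_) (0≤i⇒+∣i∣≡i (size-nonNeg (size-nonNeg ∘ bound-nonNeg)))))
      (+≤+ N≥)

    cone : Cone (a −set A) w
    cone = Cone⁺ D (a −set A) (Nu≥0 ∘ ι (a -v_) A) λ j → trans (dot-map (a -v_) A Nu j) (Nu-reflected j)

    from-semigroup : Semigrp (a −set A) w → SumSet N A v
    from-semigroup s =
      let u′ , u′≥0 , u′≡ = Semigrp⁻ (a −set A) s
          m = u′ ∘ ι⁻¹ (a -v_) A
          m≡ = λ j → trans (dot-map⁻¹ (a -v_) A u′ j) (u′≡ j)
          -- The hull coefficients, scaled by N, are the rational solution near which the integral
          -- one is moved.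
          m′ , m′≥0 , m′≡ , m′≤ = proj₂ (proj₂ (proximity (reflected i))) D {Nu} {m} Nu≥0 (u′≥0 ∘ ι⁻¹ (a -v_) A)
            λ j → trans (Nu-reflected j) (cong (+ suc D *_) (sym (m≡ j)))
      in rebalance N i m′≥0
           (rest-bound i (bound-nonNeg i) size-u heavy (term≤size (size-nonNeg ∘ bound-nonNeg) i) slack≤ m′≤) λ j →
           trans (m′≡ j) (trans (m≡ j) (lookup-reflection (+ N) a v j))

  sumset⇐ : ∀ {N v} → 0v ∈ A → threshold ℕ.≤ N → NHull N A v → ¬ ExcN N A v → SumSet N A v
  sumset⇐ {N} 0∈A N≥ hull =
    let D , u , u≥0 , size-u , u≡ = NHull⁻ N A hull
        -- The position of the origin shows that `A` is nonempty, so a heavy point exists.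
        i , heavy = heavyTerm (index 0∈A) u
    in refill i N≥ u≥0 size-u (subst (_≤ + k * u i) size-u heavy) u≡

theorem2 : (n : ℕ) (A : List (Pt n)) → 0v ∈ A → Generates A →
    Σ ℕ λ NA → (N : ℕ) → NA ℕ.≤ N → 1 ℕ.≤ N → (v : Pt n) →
    SumSet N A v ⇔ (NHull N A v × ¬ ExcN N A v)
theorem2 n A 0∈A _ = threshold A , λ { (suc N) NA≤N _ v →
  mk⇔ (sumset⇒ A) (λ (hull , ∉Exc) → sumset⇐ A 0∈A NA≤N hull ∉Exc) }
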